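{- Let $G=(V,E)$ be a finite graph with at least one vertex, $k>0$ an integer, and $\mathcal F_k^{(2)}=\{\sigma\subseteq\vec S_k:\sigma=\{(A_1,B_1),(A_2,B_2)\}\text{ is a star with }|B_1\cap B_2|<k\}$ (the two separations need not be distinct). The following are equivalent: (i) $G$ has a blockage of order $k-1$; (ii) $G$ has an $\mathcal F^{(2)}_k$-tangle of $S_k$; (iii) $G$ has no $S_k$-tree over $\mathcal F^{(2)}_k$; (iv) $G$ has path-width at least $k-1$.
   Context: A (vertex) separation of $G$ is an ordered pair $(A,B)$ with $A\cup B=V$ and no edge between $A\setminus B$ and $B\setminus A$; inverse $(B,A)$; unoriented $\{A,B\}$; $(A,B)\le(C,D)$ iff $A\subseteq C$ and $B\supseteq D$. $\vec S_k$ is the set of $(A,B)$ with $|A\cap B|<k$, $S_k$ the corresponding unoriented separations. For $\vec s$ oriented, $\overleftarrow s$ is its inverse. A star is a nonempty set $\sigma$ of oriented separations with $\vec r\le\overleftarrow s$ for all distinct $\vec r,\vec s\in\sigma$. An $\mathcal F$-tangle of $S_k$ is a subset $O\subseteq\vec S_k$ containing exactly one of $(A,B),(B,A)$ for each $\{A,B\}\in S_k$, which is consistent (no distinct $r,s$ with orientations $\vec r<\vec s$ and $\overleftarrow r,\vec s\in O$) and has no subset in $\mathcal F$. An $S_k$-tree over $\mathcal F$ is a pair $(T,\alpha)$ of a tree $T$ with at least one edge and a map $\alpha$ from ordered pairs $(x,y)$ with $xy\in E(T)$ to $\vec S_k$ such that $\alpha(y,x)$ is the inverse of $\alpha(x,y)$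 and $\{\alpha(x,t):xt\in E(T)\}\in\mathcal F$ for every node $t$. For $X\subseteq V$, $\partial(X)$ is the set of vertices in $X$ with a neighbour outside $X$. A blockage of order $k-1$ is a collection $\mathcal B$ of subsets of $V$ such that (B1) $|\partial(X)|<k$ for all $X\in\mathcal B$; (B2) $X'\in\mathcal B$ whenever $X'\subseteq X\in\mathcal B$ and $|\partial(X')|<k$; (B3) for every $\{X_1,X_2\}\in S_k$ exactly one of $X_1,X_2$ lies in $\mathcal B$. Path-width is the minimum width of a tree-decomposition whose tree is a path. -}

module Defs where

open import Data.Nat using (ℕ; _<_; _≤_; _∸_; _⊔_)
open import Data.Bool using (Bool; true; false; _∧_; not)
open import Data.Fin using (Fin; toℕ)
open import Data.Fin.Subset using (Subset; _∈_; _∉_; _⊆_; _∩_; ∣_∣)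
open import Data.Vec using (tabulate; lookup)
open import Data.List using (List; []; _∷_; _∷ʳ_; length; map; foldr; allFin)
open import Data.Bool.ListAction using (any)
open import Data.List.Relation.Unary.Linked using (Linked)
open import Data.List.Relation.Unary.Unique.Propositional using (Unique)
open import Data.Product using (Σ; ∃; _×_; _,_; proj₁; proj₂; swap)
open import Data.Sum using (_⊎_)
open import Relation.Binary.PropositionalEquality using (_≡_; _≢_)
open import Relation.Nullary using (¬_)

record Graph (n : ℕ) : Set where
  field
    adj        : Fin n → Fin n → Bool
    adj-sym    : ∀ u v → adj u v ≡ adj v u
    adj-irrefl : ∀ v → adj v v ≡ false

module _ {m : ℕ} (T : Graph m) where
  open Graph T

  Adj : Fin m → Fin m → Set
  Adj u v = adj u v ≡ true

  data Reachable : Fin m → Fin m → Set where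
    here : ∀ {x} → Reachable x x
    step : ∀ {x y z} → Adj x y → Reachable y z → Reachable x z

  Connected : Set
  Connected = ∀ x y → Reachable x y

  HasCycle : Set
  HasCycle = Σ (Fin m) λ x → Σ (List (Fin m)) λ vs → Σ (Fin m) λ y →
    let cyc = x ∷ (vs ∷ʳ y) in
    Unique cyc × (1 ≤ length vs) × Linked Adj cyc × Adj y x

  IsTree : Set
  IsTree = Connected × ¬ HasCycle

  HasEdge : Set
  HasEdge = Σ (Fin m) λ x → Σ (Fin m) λ y → Adj x y

Sep : ℕ → Set
Sep n = Subset n × Subset n

inv : ∀ {n} → Sep n → Sep n
inv = swap

_≤S_ : ∀ {n} → Sep n → Sep n → Set
(A , B) ≤S (C , D) = (A ⊆ C) × (D ⊆ B)

_<S_ : ∀ {n} → Sep n → Sep n → Set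
s <S t = (s ≤S t) × (s ≢ t)

SameUnoriented : ∀ {n} → Sep n → Sep n → Set
SameUnoriented s t = (s ≡ t) ⊎ (s ≡ inv t)

module _ {n : ℕ} (G : Graph n) where
  open Graph G

  IsSeparation : Sep n → Set
  IsSeparation (A , B) =
    (∀ v → v ∈ A ⊎ v ∈ B) ×
    (∀ u v → u ∈ A → u ∉ B → v ∈ B → v ∉ A → ¬ Adj G u v)

  InS : ℕ → Sep n → Set
  InS k (A , B) = IsSeparation (A , B) × ∣ A ∩ B ∣ < k

  IsStar2 : Sep n → Sep n → Set
  IsStar2 s₁ s₂ = s₁ ≢ s₂ → (s₁ ≤S inv s₂) × (s₂ ≤S inv s₁)

  InF2 : ℕ → Sep n → Sep n → Set
  InF2 k s₁ s₂ = InS k s₁ × InS k s₂ × IsStar2 s₁ s₂ × ∣ proj₂ s₁ ∩ proj₂ s₂ ∣ < k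

  _∈O_ : Sep n → (Subset n → Subset n → Bool) → Set
  (A , B) ∈O O = O A B ≡ true

  record F2Tangle (k : ℕ) (O : Subset n → Subset n → Bool) : Set where
    field
      ⊆S⃗      : ∀ s → s ∈O O → InS k s
      orients  : ∀ s → InS k s →
                 (s ∈O O ⊎ inv s ∈O O) × (s ≢ inv s → ¬ (s ∈O O × inv s ∈O O))
      consistent : ∀ r s → ¬ (¬ SameUnoriented r s × r <S s × inv r ∈O O × s ∈O O)
      F-free   : ∀ s₁ s₂ → s₁ ∈O O → s₂ ∈O O → ¬ InF2 k s₁ s₂

  record F2STree (k : ℕ) : Set where
    field
      m       : ℕ
      T       : Graph m
      isTree  : IsTree T
      hasEdge : HasEdge T
      α       : Fin m → Fin m → Sep n
      α-S     : ∀ x y → Adj T x y → InS k (α x y)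
      α-inv   : ∀ x y → Adj T x y → α y x ≡ inv (α x y)
      α-node  : ∀ t → Σ (Sep n) λ s₁ → Σ (Sep n) λ s₂ →
                  InF2 k s₁ s₂ ×
                  (∀ x → Adj T x t → (α x t ≡ s₁) ⊎ (α x t ≡ s₂)) ×
                  (∃ λ x → Adj T x t × α x t ≡ s₁) ×
                  (∃ λ x → Adj T x t × α x t ≡ s₂)

  ∂ : Subset n → Subset n
  ∂ X = tabulate λ v → lookup X v ∧ any (λ u → adj v u ∧ not (lookup X u)) (allFin n)

  -- blockage of order k-1 (𝓑 given as a decidable collection of vertex sets)
  record Blockage (k : ℕ) (𝓑 : Subset n → Bool) : Set where
    field
      B1 : ∀ X → 𝓑 X ≡ true → ∣ ∂ X ∣ < k
      B2 : ∀ X X′ → X′ ⊆ X → 𝓑 X ≡ true → ∣ ∂ X′ ∣ < k → 𝓑 X′ ≡ true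
      B3 : ∀ X₁ X₂ → InS k (X₁ , X₂) →
           (𝓑 X₁ ≡ true ⊎ 𝓑 X₂ ≡ true) × (X₁ ≢ X₂ → ¬ (𝓑 X₁ ≡ true × 𝓑 X₂ ≡ true))

  record PathDecomposition : Set where
    field
      r     : ℕ
      bag   : Fin r → Subset n
      covers-vertices : ∀ v → ∃ λ i → v ∈ bag i
      covers-edges    : ∀ u v → Adj G u v → ∃ λ i → (u ∈ bag i) × (v ∈ bag i)
      interval        : ∀ v i j l → toℕ i ≤ toℕ j → toℕ j ≤ toℕ l →
                        v ∈ bag i → v ∈ bag l → v ∈ bag j

  width : PathDecomposition → ℕ
  width D = foldr _⊔_ 0 (map (λ i → ∣ bag i ∣) (allFin r)) ∸ 1
    where open PathDecomposition D

  PathWidthAtLeast : ℕ → Set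
  PathWidthAtLeast w = ∀ (D : PathDecomposition) → w ≤ width D

{-# OPTIONS --safe #-}
module Submission where

-- Write s → t for separations s ≤ t in S_k with |B_s ∩ A_t| < k, and p ⇝ w if a chain of such steps
-- leads from some p′ ≤ p to some w′ ≥ w. A chain from (∅ , V) to (V , ∅) is the same thing as a
-- path-decomposition into bags B_i ∩ A_{i+1} of size < k, and also as an S_k-tree on a path.
-- Submodularity makes ⇝ transitive: given chains p′ → … → q′ and r → … → w′ with r ≤ q′, choose u of
-- least order between r and q′, meet the first chain with u and join the second one with u.
-- If (∅ , V) ⇝ (V , ∅) fails, then {q : (∅ , V) ⇝ q} is a partial orientation of S_k closed under ⇝,
-- and as long as it is not total one can add {q : s ⇝ q} for a minimal unoriented s: a chain
-- witnessing s ⇝ inv s would have to start at s and end at inv s, so s ≤ inv s, and s would be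
-- oriented already. A total orientation closed under ⇝ is a tangle.
-- Conversely, a tangle is closed under steps, so that it excludes narrow path-decompositions, and
-- in an S_k-tree it allows one to walk on from every node without ever turning back.

open import Defs
open import Data.Bool using (Bool; true; false; _∧_; not)
import Data.Bool.Properties as Bool
open import Data.Empty using (⊥-elim) renaming (⊥ to Absurd)
open import Data.Fin using (Fin; zero; suc; toℕ; fromℕ<; inject₁)
import Data.Fin.Properties as Fin
open import Data.Fin.Properties using (all?; any?; toℕ-fromℕ<; toℕ<n; toℕ-injective; toℕ-inject₁; pigeonhole)
open import Data.Fin.Induction using (<-weakInduction)
open import Data.Fin.Subset
open import Data.Fin.Subset.Properties
open import Data.List using (List; []; _∷_; _∷ʳ_; _++_; map; foldr; allFin; applyUpTo; cartesianProduct)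
open import Data.List.Properties using (applyUpTo-∷ʳ; length-applyUpTo)
open import Data.List.Membership.Propositional using (lose) renaming (_∈_ to _∈ˡ_; find to findˡ)
open import Data.List.Membership.Propositional.Properties
  using (∈-allFin; ∈-++⁺ˡ; ∈-++⁺ʳ; ∈-map⁺; ∈-cartesianProduct⁺)
open import Data.List.Relation.Unary.All using (_∷_)
open import Data.List.Relation.Unary.AllPairs using (_∷_)
open import Data.List.Relation.Unary.Any using (here; there)
open import Data.List.Relation.Unary.Any.Properties using (any⁺; any⁻)
open import Data.List.Relation.Unary.Linked using (Linked; [-]; _∷_)
import Data.List.Relation.Unary.Linked.Properties as Linked
open import Data.List.Relation.Unary.Unique.Propositional using (Unique)
import Data.List.Relation.Unary.Unique.Propositional.Properties as Unique
open import Data.Nat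
  using (ℕ; zero; suc; _+_; _∸_; _⊔_; _≤_; _≤′_; ≤′-reflexive; ≤′-step; _<_; s≤s; s≤s⁻¹; z≤n; z<s; _<?_; _≤?_)
open import Data.Nat.Induction using (Acc; acc; <-wellFounded)
open import Data.Nat.Properties
open import Data.Product using (Σ; ∃; ∃₂; _×_; _,_; proj₁; proj₂)
import Data.Product.Properties as Product
open import Data.Sum using (_⊎_; inj₁; inj₂; [_,_]′)
import Data.Sum as Sum
open import Data.Vec using ([]; _∷_; tabulate; lookup; there)
open import Data.Vec.Properties using (≡-dec; lookup∘tabulate; []=⇒lookup; lookup⇒[]=)
open import Function using (_∘_; id; flip)
open import Function.Bundles using (_⇔_; mk⇔; Equivalence)
open import Relation.Binary using (DecidableEquality)
open import Relation.Binary.PropositionalEquality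
  using (_≡_; _≢_; refl; sym; trans; cong; cong₂; subst; module ≡-Reasoning)
open import Relation.Nullary using (¬_; Dec; yes; no; does; contradiction)
open import Relation.Nullary.Decidable using (map′; dec-true; dec-false; _×-dec_; _⊎-dec_; _→-dec_; ¬?)
open import Relation.Unary using (Decidable)

private
  variable
    m n : ℕ

-- Separations

∣p∪q∣+∣p∩q∣≡∣p∣+∣q∣ : (p q : Subset n) → ∣ p ∪ q ∣ + ∣ p ∩ q ∣ ≡ ∣ p ∣ + ∣ q ∣
∣p∪q∣+∣p∩q∣≡∣p∣+∣q∣ []          []          = refl
∣p∪q∣+∣p∩q∣≡∣p∣+∣q∣ (false ∷ p) (false ∷ q) = ∣p∪q∣+∣p∩q∣≡∣p∣+∣q∣ p q
∣p∪q∣+∣p∩q∣≡∣p∣+∣q∣ (true  ∷ p) (false ∷ q) = cong suc (∣p∪q∣+∣p∩q∣≡∣p∣+∣q∣ p q)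
∣p∪q∣+∣p∩q∣≡∣p∣+∣q∣ (false ∷ p) (true  ∷ q) =
  trans (cong suc (∣p∪q∣+∣p∩q∣≡∣p∣+∣q∣ p q)) (sym (+-suc ∣ p ∣ ∣ q ∣))
∣p∪q∣+∣p∩q∣≡∣p∣+∣q∣ (true  ∷ p) (true  ∷ q) =
  cong suc (trans (+-suc ∣ p ∪ q ∣ ∣ p ∩ q ∣)
    (trans (cong suc (∣p∪q∣+∣p∩q∣≡∣p∣+∣q∣ p q)) (sym (+-suc ∣ p ∣ ∣ q ∣))))

-- Double counting: each sum counts the elements in at least one of the sets and those in both.
∣∣+∣∣-mono : (p q r s : Subset n) → p ∪ q ⊆ r ∪ s → p ∩ q ⊆ r ∩ s → ∣ p ∣ + ∣ q ∣ ≤ ∣ r ∣ + ∣ s ∣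
∣∣+∣∣-mono p q r s ∪⊆ ∩⊆ = begin
  ∣ p ∣ + ∣ q ∣          ≡⟨ ∣p∪q∣+∣p∩q∣≡∣p∣+∣q∣ p q ⟨
  ∣ p ∪ q ∣ + ∣ p ∩ q ∣  ≤⟨ +-mono-≤ (p⊆q⇒∣p∣≤∣q∣ ∪⊆) (p⊆q⇒∣p∣≤∣q∣ ∩⊆) ⟩
  ∣ r ∪ s ∣ + ∣ r ∩ s ∣  ≡⟨ ∣p∪q∣+∣p∩q∣≡∣p∣+∣q∣ r s ⟩
  ∣ r ∣ + ∣ s ∣          ∎
  where open ≤-Reasoning

⊆∧≢⇒⊂ : {p q : Subset n} → p ⊆ q → p ≢ q → p ⊂ q
⊆∧≢⇒⊂ {p = p} {q} p⊆q p≢q with p ⊂? q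
... | yes p⊂q = p⊂q
... | no  p⊄q = ⊥-elim (p≢q (⊆-antisym p⊆q q⊆p))
  where
  q⊆p : q ⊆ p
  q⊆p {x} x∈q with x ∈? p
  ... | yes x∈p = x∈p
  ... | no  x∉p = ⊥-elim (p⊄q (p⊆q , x , x∈q , x∉p))

p⊆q⇒∣p∣≤∣p∩q∣ : {p q : Subset n} → p ⊆ q → ∣ p ∣ ≤ ∣ p ∩ q ∣
p⊆q⇒∣p∣≤∣p∩q∣ p⊆q = p⊆q⇒∣p∣≤∣q∣ λ x∈p → x∈p∩q⁺ (x∈p , p⊆q x∈p)

∩-⊆-swap : (p q : Subset n) → p ∩ q ⊆ q ∩ p
∩-⊆-swap p q x∈ with x∈p∩q⁻ p q x∈
... | x∈p , x∈q = x∈p∩q⁺ (x∈q , x∈p)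

_≟S_ : DecidableEquality (Sep n)
_≟S_ = Product.≡-dec (≡-dec Bool._≟_) (≡-dec Bool._≟_)

≤S-refl : {s : Sep n} → s ≤S s
≤S-refl = id , id

≤S-trans : {s t u : Sep n} → s ≤S t → t ≤S u → s ≤S u
≤S-trans (a , b) (c , d) = (λ x → c (a x)) , (λ x → b (d x))

≤S-inv : {s t : Sep n} → s ≤S t → inv t ≤S inv s
≤S-inv (a , b) = b , a

≤S-antisym : {s t : Sep n} → s ≤S t → t ≤S s → s ≡ t
≤S-antisym (a , b) (c , d) = cong₂ _,_ (⊆-antisym a c) (⊆-antisym d b)

_≤S?_ : (s t : Sep n) → Dec (s ≤S t)
(A , B) ≤S? (C , D) = (A ⊆? C) ×-dec (D ⊆? B)

⊥S : Sep n
⊥S = ⊥ , ⊤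

⊥S-min : {s : Sep n} → ⊥S ≤S s
⊥S-min = ⊆-min _ , ⊆-max _

_⊓S_ _⊔S_ : Sep n → Sep n → Sep n
(A , B) ⊓S (C , D) = A ∩ C , B ∪ D
s ⊔S t = inv (inv s ⊓S inv t)

⊓S-lower₁ : (s t : Sep n) → (s ⊓S t) ≤S s
⊓S-lower₁ (A , B) (C , D) = p∩q⊆p A C , p⊆p∪q D

⊓S-lower₂ : (s t : Sep n) → (s ⊓S t) ≤S t
⊓S-lower₂ (A , B) (C , D) = p∩q⊆q A C , q⊆p∪q B D

⊔S-upper₁ : (s t : Sep n) → s ≤S (s ⊔S t)
⊔S-upper₁ s t = ≤S-inv (⊓S-lower₁ (inv s) (inv t))

⊔S-upper₂ : (s t : Sep n) → t ≤S (s ⊔S t)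
⊔S-upper₂ s t = ≤S-inv (⊓S-lower₂ (inv s) (inv t))

⊓S-greatest : (s t : Sep n) {r : Sep n} → r ≤S s → r ≤S t → r ≤S (s ⊓S t)
⊓S-greatest (A , B) (C , D) (a , b) (c , d) =
  (λ x → x∈p∩q⁺ (a x , c x)) , (λ x → [ b , d ]′ (x∈p∪q⁻ B D x))

⊔S-least : (s t : Sep n) {r : Sep n} → s ≤S r → t ≤S r → (s ⊔S t) ≤S r
⊔S-least s t a b = ≤S-inv (⊓S-greatest (inv s) (inv t) (≤S-inv a) (≤S-inv b))

⊓S-monoˡ : {s t : Sep n} (u : Sep n) → s ≤S t → (s ⊓S u) ≤S (t ⊓S u)
⊓S-monoˡ {s = s} {t} u s≤t =
  ⊓S-greatest t u (≤S-trans (⊓S-lower₁ s u) s≤t) (⊓S-lower₂ s u)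

order : Sep n → ℕ
order (A , B) = ∣ A ∩ B ∣

order-inv : (s : Sep n) → order (inv s) ≤ order s
order-inv (A , B) = p⊆q⇒∣p∣≤∣q∣ (∩-⊆-swap B A)

-- For `s` ≤ `t` this is the size of the bag between two consecutive cuts, and also the size to be
-- bounded for the star of `s` and `inv t`. `gap s s` equals the order of `s`.
gap : Sep n → Sep n → ℕ
gap s t = ∣ proj₂ s ∩ proj₁ t ∣

gap-inv : (s t : Sep n) → gap (inv t) (inv s) ≤ gap s t
gap-inv (A , B) (C , D) = p⊆q⇒∣p∣≤∣q∣ (∩-⊆-swap C B)

-- A vertex counted by both summands on the left lies in both sets on the right.
gap-submodular : (s t u : Sep n) → s ≤S t →
                 gap (s ⊓S u) (t ⊓S u) + order (s ⊔S u) ≤ gap s t + order u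
gap-submodular (A , B) (C , D) (E , F) (A⊆C , _) =
  ∣∣+∣∣-mono ((B ∪ F) ∩ (C ∩ E)) ((A ∪ E) ∩ (B ∩ F)) (B ∩ C) (E ∩ F) ∪⊆ ∩⊆
  where
  l : (B ∪ F) ∩ (C ∩ E) ⊆ (B ∩ C) ∪ (E ∩ F)
  l x∈ with x∈p∩q⁻ (B ∪ F) (C ∩ E) x∈
  ... | x∈BF , x∈CE with x∈p∩q⁻ C E x∈CE | x∈p∪q⁻ B F x∈BF
  ... | c , e | inj₁ b = x∈p∪q⁺ (inj₁ (x∈p∩q⁺ (b , c)))
  ... | c , e | inj₂ f = x∈p∪q⁺ (inj₂ (x∈p∩q⁺ (e , f)))
  r : (A ∪ E) ∩ (B ∩ F) ⊆ (B ∩ C) ∪ (E ∩ F)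
  r x∈ with x∈p∩q⁻ (A ∪ E) (B ∩ F) x∈
  ... | x∈AE , x∈BF with x∈p∩q⁻ B F x∈BF | x∈p∪q⁻ A E x∈AE
  ... | b , f | inj₁ a = x∈p∪q⁺ (inj₁ (x∈p∩q⁺ (b , A⊆C a)))
  ... | b , f | inj₂ e = x∈p∪q⁺ (inj₂ (x∈p∩q⁺ (e , f)))
  ∪⊆ : ((B ∪ F) ∩ (C ∩ E)) ∪ ((A ∪ E) ∩ (B ∩ F)) ⊆ (B ∩ C) ∪ (E ∩ F)
  ∪⊆ x∈ = [ l , r ]′ (x∈p∪q⁻ ((B ∪ F) ∩ (C ∩ E)) ((A ∪ E) ∩ (B ∩ F)) x∈)
  ∩⊆ : ((B ∪ F) ∩ (C ∩ E)) ∩ ((A ∪ E) ∩ (B ∩ F)) ⊆ (B ∩ C) ∩ (E ∩ F)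
  ∩⊆ x∈ with x∈p∩q⁻ ((B ∪ F) ∩ (C ∩ E)) ((A ∪ E) ∩ (B ∩ F)) x∈
  ... | x∈l , x∈r with x∈p∩q⁻ C E (p∩q⊆q (B ∪ F) (C ∩ E) x∈l)
                     | x∈p∩q⁻ B F (p∩q⊆q (A ∪ E) (B ∩ F) x∈r)
  ... | c , e | b , f = x∈p∩q⁺ (x∈p∩q⁺ (b , c) , x∈p∩q⁺ (e , f))

order-submodular : (s u : Sep n) → order (s ⊓S u) + order (s ⊔S u) ≤ order s + order u
order-submodular s u = begin
  order (s ⊓S u) + order (s ⊔S u)        ≤⟨ +-monoˡ-≤ _ (order-inv (inv (s ⊓S u))) ⟩
  gap (s ⊓S u) (s ⊓S u) + order (s ⊔S u) ≤⟨ gap-submodular s s u ≤S-refl ⟩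
  gap s s + order u                      ≤⟨ +-monoˡ-≤ _ (order-inv s) ⟩
  order s + order u                      ∎
  where open ≤-Reasoning

-- A rank function, strictly monotone for `_<S_`. It measures the recursion in `chain?` and fixes
-- the levels in which separations get oriented.
height : Sep n → ℕ
height (A , B) = ∣ A ∣ + ∣ ∁ B ∣

height-bound : (s : Sep n) → height s ≤ n + n
height-bound (A , B) = +-mono-≤ (∣p∣≤n A) (∣p∣≤n (∁ B))

height-mono : {s t : Sep n} → s <S t → height s < height t
height-mono {s = A , B} {C , D} ((A⊆C , D⊆B) , s≢t) with ≡-dec Bool._≟_ A C
... | no  A≢C = +-mono-<-≤ (p⊂q⇒∣p∣<∣q∣ (⊆∧≢⇒⊂ A⊆C A≢C)) (p⊆q⇒∣p∣≤∣q∣ (p⊆q⇒∁p⊇∁q D⊆B))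
... | yes refl = +-mono-≤-< (≤-refl {x = ∣ A ∣})
  (p⊂q⇒∣p∣<∣q∣ (p⊂q⇒∁p⊃∁q (⊆∧≢⇒⊂ D⊆B λ { refl → s≢t refl })))

anySep? : {P : Sep n → Set} → Decidable P → Dec (∃ P)
anySep? P? = map′ (λ (A , B , p) → (A , B) , p) (λ ((A , B) , p) → A , B , p)
  (anySubset? λ A → anySubset? λ B → P? (A , B))

minimize : {P : Sep n → Set} → Decidable P → (f : Sep n → ℕ) → ∃ P →
           ∃ λ u → P u × (∀ x → P x → f u ≤ f x)
minimize {P = P} P? f (u₀ , p₀) = go u₀ p₀ (<-wellFounded (f u₀))
  where
  go : ∀ u → P u → Acc _<_ (f u) → ∃ λ u → P u × (∀ x → P x → f u ≤ f x)
  go u p (acc rs) with anySep? (λ x → P? x ×-dec (f x <? f u))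
  ... | yes (x , q , fx<fu) = go x q (rs fx<fu)
  ... | no  none            = u , p , λ x q → ≮⇒≥ λ fx<fu → none (x , q , fx<fu)

module _ (G : Graph n) where

  Adj? : ∀ u v → Dec (Adj G u v)
  Adj? u v = Graph.adj G u v Bool.≟ true

  isSeparation? : Decidable (IsSeparation G)
  isSeparation? (A , B) =
    all? (λ v → (v ∈? A) ⊎-dec (v ∈? B)) ×-dec
    all? (λ u → all? λ v → (u ∈? A) →-dec (¬? (u ∈? B) →-dec ((v ∈? B) →-dec
      (¬? (v ∈? A) →-dec ¬? (Adj? u v)))))

  InS? : ∀ k → Decidable (InS G k)
  InS? k s@(A , B) = isSeparation? s ×-dec (∣ A ∩ B ∣ <? k)

  Adj-sym : ∀ {u v} → Adj G u v → Adj G v u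
  Adj-sym {u} {v} uv = trans (Graph.adj-sym G v u) uv

  isSeparation-inv : ∀ s → IsSeparation G s → IsSeparation G (inv s)
  isSeparation-inv s (cov , sep) =
    (λ v → [ inj₂ , inj₁ ]′ (cov v)) ,
    (λ u v u∈B u∉A v∈A v∉B uv → sep v u v∈A v∉B u∈B u∉A (Adj-sym uv))

  isSeparation-⊓ : ∀ s t → IsSeparation G s → IsSeparation G t → IsSeparation G (s ⊓S t)
  isSeparation-⊓ (A , B) (C , D) (cov₁ , sep₁) (cov₂ , sep₂) = cov , sep
    where
    cov : ∀ v → v ∈ A ∩ C ⊎ v ∈ B ∪ D
    cov v with cov₁ v | cov₂ v
    ... | inj₁ a | inj₁ c = inj₁ (x∈p∩q⁺ (a , c))
    ... | inj₂ b | _      = inj₂ (x∈p∪q⁺ (inj₁ b))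
    ... | inj₁ _ | inj₂ d = inj₂ (x∈p∪q⁺ (inj₂ d))
    sep : ∀ u v → u ∈ A ∩ C → u ∉ B ∪ D → v ∈ B ∪ D → v ∉ A ∩ C → ¬ Adj G u v
    sep u v u∈ u∉ v∈ v∉ uv with x∈p∩q⁻ A C u∈ | v ∈? A | v ∈? C
    ... | a , c | yes v∈A | yes v∈C = v∉ (x∈p∩q⁺ (v∈A , v∈C))
    ... | a , c | no  v∉A | _       = sep₁ u v a (λ b → u∉ (x∈p∪q⁺ (inj₁ b)))
                                        ([ (λ v∈A → contradiction v∈A v∉A) , id ]′ (cov₁ v)) v∉A uv
    ... | a , c | yes _   | no  v∉C = sep₂ u v c (λ d → u∉ (x∈p∪q⁺ (inj₂ d)))
                                        ([ (λ v∈C → contradiction v∈C v∉C) , id ]′ (cov₂ v)) v∉C uv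

  isSeparation-⊔ : ∀ s t → IsSeparation G s → IsSeparation G t → IsSeparation G (s ⊔S t)
  isSeparation-⊔ s t p q = isSeparation-inv (inv s ⊓S inv t)
    (isSeparation-⊓ (inv s) (inv t) (isSeparation-inv s p) (isSeparation-inv t q))

  InS-inv : ∀ {k} s → InS G k s → InS G k (inv s)
  InS-inv s (sep , <k) = isSeparation-inv s sep , ≤-<-trans (order-inv s) <k

  InS-⊥S : ∀ {k} → 0 < k → InS G k ⊥S
  InS-⊥S 0<k = ((λ v → inj₂ ∈⊤) , λ u v u∈⊥ → contradiction u∈⊥ ∉⊥) ,
    ≤-<-trans (≤-trans (∣p∩q∣≤∣p∣ (⊥ {n = n}) ⊤) (≤-reflexive (∣⊥∣≡0 n))) 0<k

-- Chains of separations

subsets : ∀ n → List (Subset n)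
subsets zero    = [] ∷ []
subsets (suc n) = map (true ∷_) (subsets n) ++ map (false ∷_) (subsets n)

∈-subsets : (p : Subset n) → p ∈ˡ subsets n
∈-subsets []          = here refl
∈-subsets (true  ∷ p) = ∈-++⁺ˡ (∈-map⁺ (true ∷_) (∈-subsets p))
∈-subsets (false ∷ p) = ∈-++⁺ʳ (map (true ∷_) (subsets _)) (∈-map⁺ (false ∷_) (∈-subsets p))

seps : ∀ n → List (Sep n)
seps n = cartesianProduct (subsets n) (subsets n)

∈-seps : (s : Sep n) → s ∈ˡ seps n
∈-seps (A , B) = ∈-cartesianProduct⁺ (∈-subsets A) (∈-subsets B)

module _ (G : Graph n) (k : ℕ) where

  -- A step from `s` to `t` makes `s` and `inv t` a forbidden star, so a tangle containing `s` must
  -- contain `t`. Steps need not be strict.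
  record Step (s t : Sep n) : Set where
    constructor mkStep
    field
      source : InS G k s
      target : InS G k t
      le     : s ≤S t
      gap<k  : gap s t < k
  open Step

  infixr 5 _∷_
  data Chain : Sep n → Sep n → Set where
    [_] : ∀ {s} → InS G k s → Chain s s
    _∷_ : ∀ {s t u} → Step s t → Chain t u → Chain s u

  step? : ∀ s t → Dec (Step s t)
  step? s t = map′ (λ (a , b , c , d) → mkStep a b c d) (λ (mkStep a b c d) → a , b , c , d)
    (InS? G k s ×-dec InS? G k t ×-dec (s ≤S? t) ×-dec (gap s t <? k))

  step-inv : ∀ {s t} → Step s t → Step (inv t) (inv s)
  step-inv {s} {t} (mkStep a b c d) =
    mkStep (InS-inv G t b) (InS-inv G s a) (≤S-inv c) (≤-<-trans (gap-inv s t) d)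

  infixr 5 _++ᶜ_
  _++ᶜ_ : ∀ {s t u} → Chain s t → Chain t u → Chain s u
  [ _ ]   ++ᶜ d = d
  (x ∷ c) ++ᶜ d = x ∷ (c ++ᶜ d)

  chain-source : ∀ {s t} → Chain s t → InS G k s
  chain-source [ p ]   = p
  chain-source (x ∷ _) = source x

  chain-target : ∀ {s t} → Chain s t → InS G k t
  chain-target [ p ]   = p
  chain-target (_ ∷ c) = chain-target c

  chain-≤S : ∀ {s t} → Chain s t → s ≤S t
  chain-≤S [ p ]   = ≤S-refl
  chain-≤S (x ∷ c) = ≤S-trans (le x) (chain-≤S c)

  chain-inv : ∀ {s t} → Chain s t → Chain (inv t) (inv s)
  chain-inv {s} [ p ]   = [ InS-inv G s p ]
  chain-inv {s} (x ∷ c) = chain-inv c ++ᶜ step-inv x ∷ [ InS-inv G s (source x) ]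

  -- Repetitions can be dropped, so the height of the inverse may be taken to decrease at each step.
  chain? : ∀ s u → Dec (Chain s u)
  chain? s u = go s (<-wellFounded _)
    where
    go : ∀ s → Acc _<_ (height (inv s)) → Dec (Chain s u)
    go s (acc rs) with s ≟S u | InS? G k s
    ... | _        | no  s∉ = no (s∉ ∘ chain-source)
    ... | yes refl | yes s∈ = yes [ s∈ ]
    ... | no  s≢u  | yes _ = map′ from to (anySep? next?)
      where
      Next : Sep n → Set
      Next t = Step s t × height (inv t) < height (inv s) × Chain t u
      next? : Decidable Next
      next? t with step? s t | height (inv t) <? height (inv s)
      ... | no ¬st | _     = no (¬st ∘ proj₁)
      ... | yes _  | no ¬h = no (¬h ∘ proj₁ ∘ proj₂)
      ... | yes st | yes h = map′ (λ c → st , h , c) (proj₂ ∘ proj₂) (go t (rs h))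
      from : ∃ Next → Chain s u
      from (t , st , _ , c) = st ∷ c
      to : Chain s u → ∃ Next
      to [ _ ] = contradiction refl s≢u
      to (_∷_ {t = t} x c) with s ≟S t
      ... | yes refl = to c
      ... | no  s≢t  = t , x , height-mono (≤S-inv (le x) , λ eq → s≢t (cong inv (sym eq))) , c

  -- Meeting a chain with a separation u below its end keeps all orders and gaps below k,
  -- because joining the members of the chain with u cannot lower the order of u.
  module _ (u q : Sep n) (u-sep : IsSeparation G u) (u≤q : u ≤S q)
           (u-min : ∀ x → IsSeparation G x → u ≤S x → x ≤S q → order u ≤ order x) where

    join-order : ∀ {s} → IsSeparation G s → s ≤S q → order u ≤ order (s ⊔S u)
    join-order {s} s-sep s≤q = u-min (s ⊔S u) (isSeparation-⊔ G s u s-sep u-sep)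
      (⊔S-upper₂ s u) (⊔S-least s u s≤q u≤q)

    InS-⊓ : ∀ {s} → InS G k s → s ≤S q → InS G k (s ⊓S u)
    InS-⊓ {s} (s-sep , <k) s≤q = isSeparation-⊓ G s u s-sep u-sep ,
      ≤-<-trans (+-cancelʳ-≤ (order u) _ _
        (≤-trans (+-monoʳ-≤ (order (s ⊓S u)) (join-order s-sep s≤q)) (order-submodular s u))) <k

    step-⊓ : ∀ {s t} → t ≤S q → Step s t → Step (s ⊓S u) (t ⊓S u)
    step-⊓ {s} {t} t≤q (mkStep a b c d) =
      mkStep (InS-⊓ a s≤q) (InS-⊓ b t≤q) (⊓S-monoˡ u c)
        (≤-<-trans (+-cancelʳ-≤ (order u) _ _
          (≤-trans (+-monoʳ-≤ (gap (s ⊓S u) (t ⊓S u)) (join-order (proj₁ a) s≤q))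
                   (gap-submodular s t u c))) d)
      where
      s≤q : s ≤S q
      s≤q = ≤S-trans c t≤q

    chain-⊓ : ∀ {s t} → t ≤S q → Chain s t → Chain (s ⊓S u) (t ⊓S u)
    chain-⊓ t≤q [ p ]   = [ InS-⊓ p t≤q ]
    chain-⊓ t≤q (x ∷ c) = step-⊓ (≤S-trans (chain-≤S c) t≤q) x ∷ chain-⊓ t≤q c

  infix 4 _⇝_
  -- The slack at both ends absorbs the change that `⇝-trans` makes to the outer ends of the chains.
  -- It also lets closure under `⇝` include passing to smaller members of S_k, which will give
  -- consistency.
  record _⇝_ (p w : Sep n) : Set where
    constructor mk⇝
    field
      {p′ w′} : Sep n
      p′≤p    : p′ ≤S p
      w≤w′    : w ≤S w′
      chain   : Chain p′ w′

  ⇝-reflexive : ∀ {p q} → InS G k q → q ≤S p → p ⇝ q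
  ⇝-reflexive q∈ q≤p = mk⇝ q≤p ≤S-refl [ q∈ ]

  ⇝-step : ∀ {p q} → Step p q → p ⇝ q
  ⇝-step x = mk⇝ ≤S-refl ≤S-refl (x ∷ [ target x ])

  ⇝-inv : ∀ {p w} → p ⇝ w → inv w ⇝ inv p
  ⇝-inv (mk⇝ a b c) = mk⇝ (≤S-inv b) (≤S-inv a) (chain-inv c)

  _⇝?_ : ∀ p w → Dec (p ⇝ w)
  p ⇝? w = map′ (λ (_ , _ , a , b , c) → mk⇝ a b c) (λ (mk⇝ a b c) → _ , _ , a , b , c)
    (anySep? λ p′ → anySep? λ w′ → (p′ ≤S? p) ×-dec (w ≤S? w′) ×-dec chain? p′ w′)

  ⇝-trans : ∀ {p q w} → p ⇝ q → q ⇝ w → p ⇝ w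
  ⇝-trans (mk⇝ {p′} {q′} p′≤p q≤q′ c) (mk⇝ {r} {w′} r≤q w≤w′ d) = result
    where
    r≤q′ : r ≤S q′
    r≤q′ = ≤S-trans r≤q q≤q′
    Between : Sep n → Set
    Between x = IsSeparation G x × r ≤S x × x ≤S q′
    between? : Decidable Between
    between? x = isSeparation? G x ×-dec (r ≤S? x) ×-dec (x ≤S? q′)
    result : _ ⇝ _
    result with minimize between? order (r , proj₁ (chain-source d) , ≤S-refl , r≤q′)
    ... | u , (u-sep , r≤u , u≤q′) , u-min =
      mk⇝ (≤S-trans (⊓S-lower₁ p′ u) p′≤p) (≤S-trans w≤w′ (⊔S-upper₁ w′ u))
        -- Meeting `q′` with `u` and joining `r` with `u` both give `u`, so the modified chains can
        -- be concatenated there.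
        (subst (Chain (p′ ⊓S u)) (≤S-antisym (⊓S-lower₂ q′ u) (⊓S-greatest q′ u u≤q′ ≤S-refl)) lower
         ++ᶜ subst (λ x → Chain x (w′ ⊔S u)) (≤S-antisym (⊔S-least r u r≤u ≤S-refl) (⊔S-upper₂ r u)) upper)
      where
      lower : Chain (p′ ⊓S u) (q′ ⊓S u)
      lower = chain-⊓ u q′ u-sep u≤q′
        (λ x x-sep u≤x x≤q → u-min x (x-sep , ≤S-trans r≤u u≤x , x≤q)) ≤S-refl c
      upper : Chain (r ⊔S u) (w′ ⊔S u)
      -- Joining with `u` is meeting the inverted chain with `inv u`, which has least order between
      -- `inv q′` and `inv r`.
      upper = chain-inv (chain-⊓ (inv u) (inv r) (isSeparation-inv G u u-sep) (≤S-inv r≤u)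
        (λ x x-sep u≤x x≤r → ≤-trans (order-inv u)
          (≤-trans (u-min (inv x) (isSeparation-inv G x x-sep , ≤S-inv x≤r , ≤S-trans (≤S-inv u≤x) u≤q′))
                   (order-inv x)))
        ≤S-refl (chain-inv d))

  -- Partial orientations closed under `⇝`

  record PartialOrientation : Set₁ where
    field
      P       : Sep n → Set
      P?      : Decidable P
      closed  : ∀ {s t} → P s → s ⇝ t → P t
      hasMin  : P ⊥S
      antisym : ∀ {s} → P s → ¬ P (inv s)

    Oriented : Sep n → Set
    Oriented s = P s ⊎ P (inv s)

  open PartialOrientation using (P; P?; closed; hasMin; antisym; Oriented)

  _⊑_ : PartialOrientation → PartialOrientation → Set
  O ⊑ O′ = ∀ {s} → P O s → P O′ s

  ⊑-oriented : ∀ {O O′} → O ⊑ O′ → ∀ {s} → Oriented O s → Oriented O′ s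
  ⊑-oriented O⊑ = [ inj₁ ∘ O⊑ , inj₂ ∘ O⊑ ]′

  -- If `q` and `inv q` were both reached from `⊥S`, inverting the second chain and composing would
  -- lead from `⊥S` through `q` to `inv ⊥S`.
  leastOrientation : 0 < k → ¬ (⊥S ⇝ inv ⊥S) → PartialOrientation
  leastOrientation 0<k none = record
    { P       = ⊥S ⇝_
    ; P?      = ⊥S ⇝?_
    ; closed  = ⇝-trans
    ; hasMin  = ⇝-reflexive (InS-⊥S G 0<k) ≤S-refl
    ; antisym = λ p q → none (⇝-trans p (⇝-inv q))
    }

  -- Here `A` equals `A ∩ B` and has fewer than `k` elements, so a single step, with gap the size of
  -- `A`, leads from `⊥S` to `s`.
  small⇒oriented : ∀ O {s} → 0 < k → InS G k s → s ≤S inv s → P O s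
  small⇒oriented O {A , B} 0<k s∈ (A⊆B , _) = closed O (hasMin O) (⇝-step (mkStep (InS-⊥S G 0<k) s∈ ⊥S-min
    (≤-<-trans (≤-trans (∣p∩q∣≤∣q∣ ⊤ A) (p⊆q⇒∣p∣≤∣p∩q∣ A⊆B)) (proj₂ s∈))))

  module Extend (0<k : 0 < k) (O : PartialOrientation) (s : Sep n) (s∈ : InS G k s)
                (¬Ps : ¬ P O s) (¬Ps⁻¹ : ¬ P O (inv s))
                (below : ∀ r → InS G k r → r <S s → P O r) where

    below⇒≡ : ∀ {r} → InS G k r → r ≤S s → ¬ P O r → r ≡ s
    below⇒≡ {r} r∈ r≤s ¬Pr with r ≟S s
    ... | yes r≡s = r≡s
    ... | no  r≢s = contradiction (below r r∈ (r≤s , r≢s)) ¬Pr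

    ¬s⇝s⁻¹ : ¬ (s ⇝ inv s)
    ¬s⇝s⁻¹ (mk⇝ {p′} {w′} p′≤s s⁻¹≤w′ c)
      -- If the chain started strictly below `s`, its start would be in `O`, and closure would put
      -- `inv s` into `O`. The inverted chain settles the other end in the same way.
      with below⇒≡ (chain-source c) p′≤s (λ Pp → ¬Ps⁻¹ (closed O Pp (mk⇝ ≤S-refl s⁻¹≤w′ c)))
         | below⇒≡ (InS-inv G w′ (chain-target c)) (≤S-inv s⁻¹≤w′)
             (λ Pw → ¬Ps⁻¹ (closed O Pw (⇝-inv (mk⇝ p′≤s ≤S-refl c))))
    ... | refl | refl = ¬Ps (small⇒oriented O 0<k s∈ (chain-≤S c))

    ¬s⇝q⁻¹ : ∀ {q} → P O q → ¬ (s ⇝ inv q)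
    ¬s⇝q⁻¹ Pq s⇝ = ¬Ps⁻¹ (closed O Pq (⇝-inv s⇝))

    extend : PartialOrientation
    extend = record
      { P       = λ q → P O q ⊎ s ⇝ q
      ; P?      = λ q → P? O q ⊎-dec (s ⇝? q)
      ; closed  = λ { (inj₁ Pq) q⇝ → inj₁ (closed O Pq q⇝) ; (inj₂ s⇝q) q⇝ → inj₂ (⇝-trans s⇝q q⇝) }
      ; hasMin  = inj₁ (hasMin O)
      ; antisym = λ
        { (inj₁ p) (inj₁ q) → antisym O p q
        ; (inj₁ p) (inj₂ q) → ¬s⇝q⁻¹ p q
        ; (inj₂ p) (inj₁ q) → ¬s⇝q⁻¹ q p
        ; (inj₂ p) (inj₂ q) → ¬s⇝s⁻¹ (⇝-trans p (⇝-inv q))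
        }
      }

  orient : 0 < k → ∀ O s → InS G k s → (∀ r → InS G k r → r <S s → Oriented O r) →
           ∃ λ O′ → O ⊑ O′ × Oriented O′ s
  orient 0<k O s s∈ below with P? O s | P? O (inv s)
  ... | yes Ps | _        = O , id , inj₁ Ps
  ... | no  _  | yes Ps⁻¹ = O , id , inj₂ Ps⁻¹
  ... | no ¬Ps | no ¬Ps⁻¹ = extend , inj₁ , inj₁ (inj₂ (⇝-reflexive s∈ ≤S-refl))
    where
    below′ : ∀ r → InS G k r → r <S s → P O r
    -- `inv r` lies above `inv s`, so its presence in `O` would bring in `inv s`.
    below′ r r∈ r<s = [ id , (λ Pr⁻¹ → contradiction
      (closed O Pr⁻¹ (⇝-reflexive (InS-inv G s s∈) (≤S-inv (proj₁ r<s)))) ¬Ps⁻¹) ]′ (below r r∈ r<s)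
    open Extend 0<k O s s∈ ¬Ps ¬Ps⁻¹ below′

  OrientsBelow : ℕ → PartialOrientation → Set
  OrientsBelow j O = ∀ s → InS G k s → height s < j → Oriented O s

  -- Induction on the height, running through the list of all pairs at each level. Whatever is
  -- strictly below has smaller height and stays oriented when the orientation grows.
  orientAll : 0 < k → PartialOrientation → ∀ j → ∃ λ O → OrientsBelow j O
  orientAll 0<k O₀ zero    = O₀ , λ _ _ ()
  orientAll 0<k O₀ (suc j) with orientAll 0<k O₀ j
  ... | O₁ , low with level (seps n)
    where
    level : ∀ xs → ∃ λ O → O₁ ⊑ O × (∀ {s} → s ∈ˡ xs → InS G k s → height s < suc j → Oriented O s)
    level []       = O₁ , id , λ ()
    level (x ∷ xs) with level xs
    ... | O , O₁⊑O , done with InS? G k x ×-dec (height x <? suc j)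
    ...   | no  skip = O , O₁⊑O , λ { (here refl) s∈ h → contradiction (s∈ , h) skip ; (there s∈xs) → done s∈xs }
    ...   | yes (x∈ , s≤s hx) with orient 0<k O x x∈ (λ r r∈ r<x → ⊑-oriented {O₁} {O} O₁⊑O (low r r∈ (≤-trans (height-mono r<x) hx)))
    ...     | O′ , O⊑O′ , x-done = O′ , O⊑O′ ∘ O₁⊑O ,
      λ { (here refl) _ _ → x-done ; (there s∈xs) s∈ h → ⊑-oriented {O} {O′} O⊑O′ (done s∈xs s∈ h) }
  ... | O , _ , done = O , λ s → done (∈-seps s)

  fullOrientation : 0 < k → ¬ (⊥S ⇝ inv ⊥S) → ∃ λ O → ∀ s → InS G k s → Oriented O s
  fullOrientation 0<k none with orientAll 0<k (leastOrientation 0<k none) (suc (n + n))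
  ... | O , done = O , λ s s∈ → done s s∈ (s≤s (height-bound s))

-- Tangles and blockages

does⇒ : {A : Set} (a? : Dec A) → does a? ≡ true → A
does⇒ (yes a) _ = a

⟦_⟧ : {P : Fin n → Set} → Decidable P → Subset n
⟦ P? ⟧ = tabulate (does ∘ P?)

∈⟦⟧⁺ : {P : Fin n → Set} (P? : Decidable P) {v : Fin n} → P v → v ∈ ⟦ P? ⟧
∈⟦⟧⁺ P? {v} p = lookup⇒[]= v _ (trans (lookup∘tabulate (does ∘ P?) v) (dec-true (P? v) p))

∈⟦⟧⁻ : {P : Fin n → Set} (P? : Decidable P) {v : Fin n} → v ∈ ⟦ P? ⟧ → P v
∈⟦⟧⁻ P? {v} v∈ = does⇒ (P? v) (trans (sym (lookup∘tabulate (does ∘ P?) v)) ([]=⇒lookup v∈))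

Empty⇒∣∣≡0 : (p : Subset n) → (∀ {v} → v ∉ p) → ∣ p ∣ ≡ 0
Empty⇒∣∣≡0 {n} p empty = trans (cong ∣_∣ (Empty-unique λ (_ , v∈p) → empty v∈p)) (∣⊥∣≡0 n)

∈⇒0<∣∣ : {p : Subset n} {v : Fin n} → v ∈ p → 0 < ∣ p ∣
∈⇒0<∣∣ {p = true  ∷ p} v∈                = z<s
∈⇒0<∣∣ {p = false ∷ p} (there v∈) = ∈⇒0<∣∣ v∈

module _ {A : Set} (f : A → ℕ) where

  f≤max : ∀ {x xs} → x ∈ˡ xs → f x ≤ foldr _⊔_ 0 (map f xs)
  f≤max (here refl)  = m≤m⊔n _ _
  f≤max (there x∈xs) = ≤-trans (f≤max x∈xs) (m≤n⊔m _ _)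

  max≤ : ∀ {b} xs → (∀ x → f x ≤ b) → foldr _⊔_ 0 (map f xs) ≤ b
  max≤ []       f≤ = z≤n
  max≤ (x ∷ xs) f≤ = ⊔-lub (f≤ x) (max≤ xs f≤)

module _ (G : Graph n) (k : ℕ) where

  -- Both separators lie in `B ∩ C`, so the bound on the gap bounds the two orders as well.
  mkStep′ : ∀ s t → IsSeparation G s → IsSeparation G t → s ≤S t → gap s t < k → Step G k s t
  mkStep′ (A , B) (C , D) s-sep t-sep (A⊆C , D⊆B) <k = mkStep
    (s-sep , ≤-<-trans (p⊆q⇒∣p∣≤∣q∣ λ x∈ → x∈p∩q⁺ (p∩q⊆q A B x∈ , A⊆C (p∩q⊆p A B x∈))) <k)
    (t-sep , ≤-<-trans (p⊆q⇒∣p∣≤∣q∣ λ x∈ → x∈p∩q⁺ (D⊆B (p∩q⊆q C D x∈) , p∩q⊆p C D x∈)) <k)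
    (A⊆C , D⊆B) <k

  module Tangle {O : Subset n → Subset n → Bool} (𝒯 : F2Tangle G k O) where
    open F2Tangle 𝒯

    In : Sep n → Set
    In (A , B) = O A B ≡ true

    in? : Decidable In
    in? (A , B) = O A B Bool.≟ true

    -- The two members of a forbidden star may coincide; for the star consisting of `s` alone the
    -- bound is on the size of its right-hand side.
    ¬small-right : ∀ s → In s → ¬ (∣ proj₂ s ∣ < k)
    ¬small-right s@(A , B) s∈O <k = F-free s s s∈O s∈O
      (⊆S⃗ s s∈O , ⊆S⃗ s s∈O , (λ s≢s → contradiction refl s≢s) , ≤-<-trans (∣p∩q∣≤∣p∣ B B) <k)

    -- `orients` excludes the pair only if `s` differs from its inverse. Otherwise `A` and `B`
    -- coincide and have fewer than `k` elements.
    ¬both : ∀ s → In s → ¬ In (inv s)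
    ¬both s@(A , B) s∈O s⁻¹∈O with s ≟S inv s
    ... | no  s≢s⁻¹ = proj₂ (orients s (⊆S⃗ s s∈O)) s≢s⁻¹ (s∈O , s⁻¹∈O)
    ... | yes refl  = ¬small-right s s∈O
      (≤-<-trans (p⊆q⇒∣p∣≤∣p∩q∣ {p = A} id) (proj₂ (⊆S⃗ s s∈O)))

    -- Consistency speaks of different unoriented separations. If `r` is `s`, this is `¬both`; if
    -- `r` is `inv s`, the right-hand side of `s` lies in its left-hand side and is small.
    downward : ∀ r s → r ≤S s → In s → ¬ In (inv r)
    downward r s r≤s s∈O r⁻¹∈O with r ≟S s | r ≟S inv s
    ... | yes refl | _        = ¬both r s∈O r⁻¹∈O
    ... | no  _    | yes refl = ¬small-right s s∈O (≤-<-trans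
      (p⊆q⇒∣p∣≤∣q∣ λ x∈ → x∈p∩q⁺ (proj₁ r≤s x∈ , x∈)) (proj₂ (⊆S⃗ s s∈O)))
    ... | no  r≢s  | no  r≢s⁻¹ = consistent r s ([ r≢s , r≢s⁻¹ ]′ , (r≤s , r≢s) , r⁻¹∈O , s∈O)

    step-closed : ∀ s t → Step G k s t → In s → In t
    step-closed s t st s∈O with proj₁ (orients t (Step.target st))
    ... | inj₁ t∈O   = t∈O
    ... | inj₂ t⁻¹∈O = ⊥-elim (F-free s (inv t) s∈O t⁻¹∈O
      (Step.source st , InS-inv G t (Step.target st) , (λ _ → Step.le st , ≤S-inv (Step.le st)) , Step.gap<k st))

    ⊥S∈ : 0 < k → In ⊥S
    ⊥S∈ 0<k with proj₁ (orients ⊥S (InS-⊥S G 0<k))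
    ... | inj₁ p = p
    ... | inj₂ p = ⊥-elim (¬small-right (inv ⊥S) p (subst (_< k) (sym (∣⊥∣≡0 n)) 0<k))

  -- Closure under `⇝` does the work: going down gives consistency, and taking steps excludes
  -- forbidden stars.
  orientation⇒tangle : 0 < k → (∃ λ O → ∀ s → InS G k s → PartialOrientation.Oriented {G = G} {k} O s) →
                       Σ (Subset n → Subset n → Bool) (F2Tangle G k)
  orientation⇒tangle 0<k (Ω , total) = (λ A B → does (in? (A , B))) , record
    { ⊆S⃗        = λ s s∈ → proj₁ (out s∈)
    ; orients    = λ s s∈S →
        [ (λ p → inj₁ (dec-true (in? s) (s∈S , p)))
        , (λ p → inj₂ (dec-true (in? (inv s)) (InS-inv G s s∈S , p))) ]′ (total s s∈S)
        , λ _ (s∈ , s⁻¹∈) → antisym (proj₂ (out s∈)) (proj₂ (out s⁻¹∈))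
    ; consistent = λ r s (_ , (r≤s , _) , r⁻¹∈ , s∈) →
        antisym (closed (proj₂ (out s∈)) (⇝-reflexive G k (InS-inv G (inv r) (proj₁ (out r⁻¹∈))) r≤s)) (proj₂ (out r⁻¹∈))
    ; F-free     = λ s t s∈ t∈ (s∈S , t∈S , star , <k) → free s t (proj₂ (out s∈)) (proj₂ (out t∈)) s∈S t∈S star <k
    }
    where
    open PartialOrientation Ω
    -- `P` may hold for pairs outside S_k, so membership in S_k is demanded in addition.
    in? : Decidable (λ s → InS G k s × P s)
    in? s = InS? G k s ×-dec P? s
    out : ∀ {s} → does (in? s) ≡ true → InS G k s × P s
    out {s} = does⇒ (in? s)
    free : ∀ s t → P s → P t → InS G k s → InS G k t → IsStar2 G s t → ¬ (∣ proj₂ s ∩ proj₂ t ∣ < k)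
    free s t Ps Pt s∈S t∈S star <k with s ≟S t
    ... | no  s≢t  = antisym (closed Ps (⇝-step G k (mkStep s∈S (InS-inv G t t∈S) (proj₁ (star s≢t)) <k))) Pt
    -- The star is `s` alone and its right-hand side is small, so a step leads from `s` to the
    -- largest separation, contrary to `hasMin`.
    ... | yes refl = antisym hasMin (closed Ps (⇝-step G k
      (mkStep s∈S (InS-inv G ⊥S (InS-⊥S G 0<k)) (≤S-inv ⊥S-min)
        (≤-<-trans (≤-trans (∣p∩q∣≤∣p∣ (proj₂ s) ⊤) (p⊆q⇒∣p∣≤∣p∩q∣ {p = proj₂ s} id)) <k))))

  -- Vertex boundaries and blockages

  ∈∂⁺ : ∀ {X u v} → v ∈ X → Adj G v u → u ∉ X → v ∈ ∂ G X
  ∈∂⁺ {X} {u} {v} v∈X vu u∉X = lookup⇒[]= v _ (trans (lookup∘tabulate _ v) (cong₂ _∧_ ([]=⇒lookup v∈X)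
    (Equivalence.to Bool.T-≡ (any⁺ _ (lose (∈-allFin u) (Equivalence.from Bool.T-≡ (cong₂ _∧_ vu (cong not (∉⇒lookup u∉X)))))))))
    where
    ∉⇒lookup : u ∉ X → lookup X u ≡ false
    ∉⇒lookup u∉X = Bool.¬-not (λ eq → u∉X (lookup⇒[]= u X eq))

  ∈∂⁻ : ∀ {X v} → v ∈ ∂ G X → v ∈ X × ∃ λ u → Adj G v u × u ∉ X
  ∈∂⁻ {X} {v} v∈∂ with lookup X v in v∈X | trans (sym (lookup∘tabulate _ v)) ([]=⇒lookup v∈∂)
  ... | true | eq with findˡ (any⁻ _ (allFin n) (Equivalence.from Bool.T-≡ eq))
  ... | u , _ , t with Graph.adj G v u in vu | lookup X u in u∉X
  ... | true | false = lookup⇒[]= v X v∈X , u , vu , λ u∈X → contradiction (trans (sym u∉X) ([]=⇒lookup u∈X)) λ ()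

  ∂⊆∩ : ∀ A B → IsSeparation G (A , B) → ∂ G A ⊆ A ∩ B
  ∂⊆∩ A B (cov , sep) {v} v∈∂ with ∈∂⁻ v∈∂ | v ∈? B
  ... | v∈A , _            | yes v∈B = x∈p∩q⁺ (v∈A , v∈B)
  ... | v∈A , u , vu , u∉A | no  v∉B =
    contradiction vu (sep v u v∈A v∉B ([ (λ u∈A → contradiction u∈A u∉A) , id ]′ (cov u)) u∉A)

  ∂-small : ∀ A B → InS G k (A , B) → ∣ ∂ G A ∣ < k
  ∂-small A B (sep , <k) = ≤-<-trans (p⊆q⇒∣p∣≤∣q∣ (∂⊆∩ A B sep)) <k

  -- The smallest right-hand side that a separation with left-hand side `X` can have. The separator
  -- is then the boundary of `X`, which turns conditions on vertex sets into conditions on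
  -- separations.
  co∂ : Subset n → Subset n
  co∂ X = ∁ X ∪ ∂ G X

  co∂-InS : ∀ X → ∣ ∂ G X ∣ < k → InS G k (X , co∂ X)
  co∂-InS X <k = (cov , sep) , ≤-<-trans (p⊆q⇒∣p∣≤∣q∣ ∩⊆∂) <k
    where
    cov : ∀ v → v ∈ X ⊎ v ∈ co∂ X
    cov v with v ∈? X
    ... | yes v∈X = inj₁ v∈X
    ... | no  v∉X = inj₂ (x∈p∪q⁺ (inj₁ (x∉p⇒x∈∁p v∉X)))
    sep : ∀ u v → u ∈ X → u ∉ co∂ X → v ∈ co∂ X → v ∉ X → ¬ Adj G u v
    sep u v u∈X u∉ _ v∉X uv = u∉ (x∈p∪q⁺ (inj₂ (∈∂⁺ u∈X uv v∉X)))
    ∩⊆∂ : X ∩ co∂ X ⊆ ∂ G X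
    ∩⊆∂ x∈ with x∈p∩q⁻ X (co∂ X) x∈
    ... | x∈X , x∈co = [ (λ x∈∁ → contradiction x∈X (x∈∁p⇒x∉p x∈∁)) , id ]′ (x∈p∪q⁻ (∁ X) (∂ G X) x∈co)

  -- A vertex of `X` with a neighbour outside `Y` has that neighbour outside `X`.
  co∂-anti : ∀ {X Y} → X ⊆ Y → co∂ Y ⊆ co∂ X
  co∂-anti {X} {Y} X⊆Y {x} x∈ with x ∈? X | x∈p∪q⁻ (∁ Y) (∂ G Y) x∈
  ... | no  x∉X | _         = x∈p∪q⁺ (inj₁ (x∉p⇒x∈∁p x∉X))
  ... | yes x∈X | inj₁ x∈∁Y = contradiction (X⊆Y x∈X) (x∈∁p⇒x∉p x∈∁Y)
  ... | yes x∈X | inj₂ x∈∂Y with ∈∂⁻ x∈∂Y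
  ...   | _ , u , xu , u∉Y = x∈p∪q⁺ (inj₂ (∈∂⁺ x∈X xu (u∉Y ∘ X⊆Y)))

  co∂-least : ∀ A B → IsSeparation G (A , B) → co∂ A ⊆ B
  co∂-least A B s-sep@(cov , _) {x} x∈ with x∈p∪q⁻ (∁ A) (∂ G A) x∈
  ... | inj₁ x∈∁A = [ (λ x∈A → contradiction x∈A (x∈∁p⇒x∉p x∈∁A)) , id ]′ (cov x)
  ... | inj₂ x∈∂A = p∩q⊆q A B (∂⊆∩ A B s-sep x∈∂A)

  -- The blockage consists of the left-hand sides in the tangle: `tighten` replaces any right-hand
  -- side by the smallest one, in a step whose gap is the order.
  tangle⇒blockage : Σ (Subset n → Subset n → Bool) (F2Tangle G k) → Σ (Subset n → Bool) (Blockage G k)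
  tangle⇒blockage (O , 𝒯) = (λ X → O X (co∂ X)) , record
    { B1 = λ X X∈ → ∂-small X (co∂ X) (⊆S⃗ _ X∈)
    ; B2 = λ X X′ X′⊆X X∈ <k → [ id , (λ p → contradiction p
             (downward (X′ , co∂ X′) (X , co∂ X) (X′⊆X , co∂-anti X′⊆X) X∈)) ]′
             (proj₁ (orients (X′ , co∂ X′) (co∂-InS X′ <k)))
    ; B3 = λ X₁ X₂ s∈S →
        [ (λ p → inj₁ (tighten X₁ X₂ p)) , (λ p → inj₂ (tighten X₂ X₁ p)) ]′ (proj₁ (orients (X₁ , X₂) s∈S))
        , λ _ (X₁∈ , X₂∈) → [ excl X₁ X₂ X₂∈ , excl X₂ X₁ X₁∈ ]′ (proj₁ (orients (X₁ , X₂) s∈S))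
    }
    where
    open F2Tangle 𝒯
    open Tangle 𝒯
    tighten : ∀ A B → In (A , B) → In (A , co∂ A)
    tighten A B p = step-closed (A , B) (A , co∂ A)
      (mkStep s∈S (co∂-InS A (∂-small A B s∈S)) (id , co∂-least A B (proj₁ s∈S))
        (≤-<-trans (order-inv (A , B)) (proj₂ s∈S))) p
      where
      s∈S : InS G k (A , B)
      s∈S = ⊆S⃗ _ p
    excl : ∀ A B → In (B , co∂ B) → ¬ In (A , B)
    excl A B q p = downward (B , A) (B , co∂ B)
      (id , co∂-least B A (isSeparation-inv G (A , B) (proj₁ (⊆S⃗ _ p)))) q p

  blockage⇒tangle : 0 < n → 0 < k → Σ (Subset n → Bool) (Blockage G k) →
                    Σ (Subset n → Subset n → Bool) (F2Tangle G k)
  blockage⇒tangle 0<n 0<k (𝓑 , blk) = (λ A B → does (in? (A , B))) , record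
    { ⊆S⃗        = λ s s∈ → proj₁ (out s∈)
    ; orients    = λ s s∈S →
        [ (λ p → inj₁ (dec-true (in? s) (s∈S , p)))
        , (λ p → inj₂ (dec-true (in? (inv s)) (InS-inv G s s∈S , p))) ]′ (proj₁ (B3 _ _ s∈S))
        , λ _ (s∈ , s⁻¹∈) → excl s (proj₁ (out s∈)) (proj₂ (out s∈)) (proj₂ (out s⁻¹∈))
    ; consistent = λ r s (_ , ((A⊆C , _) , _) , r⁻¹∈ , s∈) →
        let r∈S = InS-inv G (inv r) (proj₁ (out r⁻¹∈)) in
        excl r r∈S (B2 _ _ A⊆C (proj₂ (out s∈)) (∂-small _ _ r∈S)) (proj₂ (out r⁻¹∈))
    ; F-free     = λ s t s∈ t∈ (s∈S , t∈S , star , <k) → free s t (proj₂ (out s∈)) (proj₂ (out t∈)) s∈S t∈S star <k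
    }
    where
    open Blockage blk
    in? : Decidable (λ s → InS G k s × 𝓑 (proj₁ s) ≡ true)
    in? s = InS? G k s ×-dec (𝓑 (proj₁ s) Bool.≟ true)
    out : ∀ {s} → does (in? s) ≡ true → InS G k s × 𝓑 (proj₁ s) ≡ true
    out {s} = does⇒ (in? s)
    ⊥≢⊤ : ⊥ {n} ≢ ⊤
    ⊥≢⊤ eq = <⇒≢ 0<n (trans (sym (∣⊥∣≡0 n)) (trans (cong ∣_∣ eq) (∣⊤∣≡n n)))
    ¬⊤∈ : ¬ 𝓑 ⊤ ≡ true
    -- `B2` would add the empty set, and `B3` allows only one of `⊥` and `⊤`, which differ because
    -- there is a vertex.
    ¬⊤∈ ⊤∈ = proj₂ (B3 ⊥ ⊤ (InS-⊥S G 0<k)) ⊥≢⊤ (B2 ⊤ ⊥ (⊆-min _) ⊤∈ (∂-small ⊥ ⊤ (InS-⊥S G 0<k)) , ⊤∈)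
    excl : ∀ s → InS G k s → 𝓑 (proj₁ s) ≡ true → ¬ 𝓑 (proj₂ s) ≡ true
    excl s@(A , B) s∈S A∈ B∈ with s ≟S inv s
    ... | no  s≢s⁻¹ = proj₂ (B3 A B s∈S) (λ { refl → s≢s⁻¹ refl }) (A∈ , B∈)
    ... | yes refl  = ¬⊤∈ (subst (λ X → 𝓑 X ≡ true) (⊆-antisym (⊆-max A) λ {v} _ → [ id , id ]′ (proj₁ (proj₁ s∈S) v)) A∈)
    free : ∀ s t → 𝓑 (proj₁ s) ≡ true → 𝓑 (proj₁ t) ≡ true → InS G k s → InS G k t → IsStar2 G s t →
           ¬ (∣ proj₂ s ∩ proj₂ t ∣ < k)
    free s@(A , B) t@(C , D) A∈ C∈ s∈S t∈S star <k with s ≟S t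
    -- `B` is small, so `(B , ⊤)` is in S_k, and `B3` puts `B` or `⊤` into the blockage.
    ... | yes refl = [ excl s s∈S A∈ , ¬⊤∈ ]′ (proj₁ (B3 B ⊤ B⊤∈S))
      where
      B⊤∈S : InS G k (B , ⊤)
      B⊤∈S = ((λ v → inj₂ ∈⊤) , λ u v _ u∉⊤ → contradiction ∈⊤ u∉⊤) ,
        ≤-<-trans (≤-trans (∣p∩q∣≤∣p∣ B ⊤) (p⊆q⇒∣p∣≤∣p∩q∣ {p = B} id)) <k
    -- `(B , D)` is in S_k: what is outside `B` lies in `A` ⊆ `D`, and an edge violating it would
    -- violate `(A , B)`. Now `B3` puts `B` next to `A` or `D` next to `C`.
    ... | no s≢t = [ excl s s∈S A∈ , excl t t∈S C∈ ]′ (proj₁ (B3 B D BD∈S))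
      where
      A⊆D : A ⊆ D
      A⊆D = proj₁ (proj₁ (star s≢t))
      BD∈S : InS G k (B , D)
      BD∈S = ((λ v → [ inj₂ ∘ A⊆D , inj₁ ]′ (proj₁ (proj₁ s∈S) v)) ,
        λ u v u∈B u∉D v∈D v∉B uv → proj₂ (proj₁ s∈S) v u
          ([ id , (λ v∈B → contradiction v∈B v∉B) ]′ (proj₁ (proj₁ s∈S) v)) v∉B u∈B (u∉D ∘ A⊆D) (Adj-sym G uv)) , <k

-- Path-decompositions

crossing : {P : ℕ → Set} → Decidable P → ∀ r → ¬ P 0 → P r → ∃ λ i → i < r × ¬ P i × P (suc i)
crossing P? zero    ¬P0 P0 = contradiction P0 ¬P0
crossing P? (suc r) ¬P0 Pr with P? r
... | no ¬p = r , ≤-refl , ¬p , Pr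
... | yes p with crossing P? r ¬P0 p
...   | i , i<r , rest = i , m≤n⇒m≤1+n i<r , rest

module _ (G : Graph n) (k : ℕ) where

  -- Cutting a decomposition with bags smaller than `k` before each bag in turn gives steps along
  -- which the tangle is led from `⊥S` to a separation with empty right-hand side.
  tangle⇒pathWidth : 0 < k → Σ (Subset n → Subset n → Bool) (F2Tangle G k) → PathWidthAtLeast G (k ∸ 1)
  tangle⇒pathWidth 0<k (O , 𝒯) D = ≮⇒≥ λ w<k → ¬narrow (λ i →
      ≤-<-trans (f≤max (λ i → ∣ bag i ∣) (∈-allFin i)) (≰⇒> (<⇒≱ w<k ∘ ∸-monoˡ-≤ 1)))
    where
    open PathDecomposition D
    open Tangle G k 𝒯
    module _ (narrow : ∀ i → ∣ bag i ∣ < k) where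
      before? : ∀ i v → Dec (∃ λ j → toℕ j < i × v ∈ bag j)
      before? i v = any? λ j → (toℕ j <? i) ×-dec (v ∈? bag j)
      after? : ∀ i v → Dec (∃ λ j → i ≤ toℕ j × v ∈ bag j)
      after? i v = any? λ j → (i ≤? toℕ j) ×-dec (v ∈? bag j)
      cut : ℕ → Sep n
      cut i = ⟦ before? i ⟧ , ⟦ after? i ⟧
      cut-sep : ∀ i → IsSeparation G (cut i)
      cut-sep i = cov , sep
        where
        cov : ∀ v → v ∈ ⟦ before? i ⟧ ⊎ v ∈ ⟦ after? i ⟧
        cov v with covers-vertices v
        ... | j , v∈ with toℕ j <? i
        ...   | yes j<i = inj₁ (∈⟦⟧⁺ (before? i) (j , j<i , v∈))
        ...   | no  j≮i = inj₂ (∈⟦⟧⁺ (after? i) (j , ≮⇒≥ j≮i , v∈))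
        sep : ∀ u v → u ∈ ⟦ before? i ⟧ → u ∉ ⟦ after? i ⟧ → v ∈ ⟦ after? i ⟧ → v ∉ ⟦ before? i ⟧ → ¬ Adj G u v
        sep u v _ u∉ _ v∉ uv with covers-edges u v uv
        ... | j , u∈ , v∈ with toℕ j <? i
        ...   | yes j<i = v∉ (∈⟦⟧⁺ (before? i) (j , j<i , v∈))
        ...   | no  j≮i = u∉ (∈⟦⟧⁺ (after? i) (j , ≮⇒≥ j≮i , u∈))
      cut-step : ∀ i → i < r → Step G k (cut i) (cut (suc i))
      cut-step i i<r = mkStep′ G k (cut i) (cut (suc i)) (cut-sep i) (cut-sep (suc i))
        ( (λ x∈ → let (j , j<i , x∈bag) = ∈⟦⟧⁻ (before? i) x∈ in
                  ∈⟦⟧⁺ (before? (suc i)) (j , m≤n⇒m≤1+n j<i , x∈bag))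
        , (λ x∈ → let (j , i<j , x∈bag) = ∈⟦⟧⁻ (after? (suc i)) x∈ in
                  ∈⟦⟧⁺ (after? i) (j , <⇒≤ i<j , x∈bag)))
        (≤-<-trans (p⊆q⇒∣p∣≤∣q∣ gap⊆bag) (narrow (fromℕ< i<r)))
        where
        -- Such a vertex is in a bag up to number `i` and in one from number `i` on, hence in bag
        -- `i` by the interval property.
        gap⊆bag : ⟦ after? i ⟧ ∩ ⟦ before? (suc i) ⟧ ⊆ bag (fromℕ< i<r)
        gap⊆bag {x} x∈ with x∈p∩q⁻ ⟦ after? i ⟧ ⟦ before? (suc i) ⟧ x∈
        ... | x∈after , x∈before with ∈⟦⟧⁻ (after? i) x∈after | ∈⟦⟧⁻ (before? (suc i)) x∈before
        ...   | j , i≤j , x∈j | l , s≤s l≤i , x∈l = interval x l (fromℕ< i<r) j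
          (≤-trans l≤i (≤-reflexive (sym (toℕ-fromℕ< i<r)))) (≤-trans (≤-reflexive (toℕ-fromℕ< i<r)) i≤j) x∈l x∈j
      cut-0 : ⊥S ≡ cut 0
      cut-0 = ≤S-antisym ⊥S-min
        ( (λ x∈ → let (_ , j<0 , _) = ∈⟦⟧⁻ (before? 0) x∈ in contradiction j<0 n≮0)
        , (λ {x} _ → let (j , x∈) = covers-vertices x in ∈⟦⟧⁺ (after? 0) (j , z≤n , x∈)))
      cut∈ : ∀ i → i ≤ r → In (cut i)
      cut∈ zero    _   = subst In cut-0 (⊥S∈ 0<k)
      cut∈ (suc i) i<r = step-closed (cut i) (cut (suc i)) (cut-step i i<r) (cut∈ i (<⇒≤ i<r))
      ¬narrow : Absurd
      ¬narrow = ¬small-right (cut r) (cut∈ r ≤-refl) (subst (_< k) (sym (Empty⇒∣∣≡0 ⟦ after? r ⟧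
        λ x∈ → let (j , r≤j , _) = ∈⟦⟧⁻ (after? r) x∈ in <⇒≱ (toℕ<n j) r≤j)) 0<k)

  record Sequence (s t : Sep n) : Set where
    field
      r      : ℕ
      f      : ℕ → Sep n
      f-0    : f 0 ≡ s
      f-r    : f r ≡ t
      f-step : ∀ i → Step G k (f i) (f (suc i))

  -- The last member is repeated forever beyond `r`, by steps whose gap is its order. This keeps
  -- index bounds out of `f-step`.
  chain⇒sequence : ∀ {s t} → Chain G k s t → Sequence s t
  chain⇒sequence {s} [ s∈S ] = record
    { r = 0 ; f = λ _ → s ; f-0 = refl ; f-r = refl
    ; f-step = λ _ → mkStep s∈S s∈S ≤S-refl (≤-<-trans (order-inv s) (proj₂ s∈S)) }
  chain⇒sequence {s} (x ∷ c) = record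
    { r = suc r ; f = f′ ; f-0 = refl ; f-r = f-r
    ; f-step = λ { zero → subst (Step G k s) (sym f-0) x ; (suc i) → f-step i } }
    where
    open Sequence (chain⇒sequence c)
    f′ : ℕ → Sep n
    f′ zero    = s
    f′ (suc i) = f i

  ⇝⇒sequence : _⇝_ G k ⊥S (inv ⊥S) → Sequence ⊥S (inv ⊥S)
  -- `⊥S` is the least pair and `inv ⊥S` the greatest, so there is no slack at the ends.
  ⇝⇒sequence (mk⇝ {p′} {w′} p′≤ ≤w′ c) with ≤S-antisym p′≤ ⊥S-min | ≤S-antisym (≤S-inv ⊥S-min) ≤w′
  ... | refl | refl = chain⇒sequence c

  module _ (σ : Sequence ⊥S (inv ⊥S)) where
    open Sequence σ

    L R : ℕ → Subset n
    L = proj₁ ∘ f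
    R = proj₂ ∘ f

    f-inS : ∀ i → InS G k (f i)
    f-inS i = Step.source (f-step i)

    f-mono : ∀ {i j} → i ≤ j → f i ≤S f j
    f-mono i≤j = go (≤⇒≤′ i≤j)
      where
      go : ∀ {i j} → i ≤′ j → f i ≤S f j
      go (≤′-reflexive refl) = ≤S-refl
      go (≤′-step i≤j)       = ≤S-trans (go i≤j) (Step.le (f-step _))

    ∉L0 : ∀ v → v ∉ L 0
    ∉L0 v v∈ = ∉⊥ (subst (λ s → v ∈ proj₁ s) f-0 v∈)

    ∈Lr : ∀ v → v ∈ L r
    ∈Lr v = subst (λ s → v ∈ proj₁ s) (sym f-r) ∈⊤

    ∉L⇒∈R : ∀ {v} i → v ∉ L i → v ∈ R i
    ∉L⇒∈R {v} i v∉ = [ (λ v∈ → contradiction v∈ v∉) , id ]′ (proj₁ (proj₁ (f-inS i)) v)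

    bags : ℕ → Subset n
    bags i = R i ∩ L (suc i)

    bags-decomposition : PathDecomposition G
    bags-decomposition = record
      { r               = r
      ; bag             = bags ∘ toℕ
      ; covers-vertices = λ v → let (i , i<r , v∉ , v∈) = crossing (λ i → v ∈? L i) r (∉L0 v) (∈Lr v) in
                                fromℕ< i<r , at i<r (x∈p∩q⁺ (∉L⇒∈R i v∉ , v∈))
      ; covers-edges    = edges
      ; interval        = λ v i j l i≤j j≤l v∈i v∈l → x∈p∩q⁺
          ( proj₂ (f-mono j≤l) (p∩q⊆p (R (toℕ l)) (L (suc (toℕ l))) v∈l)
          , proj₁ (f-mono (s≤s i≤j)) (p∩q⊆q (R (toℕ i)) (L (suc (toℕ i))) v∈i))
      }
      where
      at : ∀ {i v} (i<r : i < r) → v ∈ bags i → v ∈ bags (toℕ (fromℕ< i<r))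
      at {v = v} i<r = subst (λ j → v ∈ bags j) (sym (toℕ-fromℕ< i<r))
      edges : ∀ u v → Adj G u v → ∃ λ i → u ∈ bags (toℕ {r} i) × v ∈ bags (toℕ i)
      -- At `i` the whole edge comes to lie in `L`. An end not yet in `L i` is in `R i`, and by
      -- `other` so is its neighbour, since no edge crosses `f i`.
      edges u v uv with crossing (λ i → (u ∈? L i) ×-dec (v ∈? L i)) r (∉L0 u ∘ proj₁) (∈Lr u , ∈Lr v)
      ... | i , i<r , ¬uv∈ , u∈ , v∈ =
        fromℕ< i<r , at i<r (x∈p∩q⁺ (proj₁ both , u∈)) , at i<r (x∈p∩q⁺ (proj₂ both , v∈))
        where
        other : ∀ {x y} → Adj G x y → x ∉ L i → y ∈ R i
        other {x} {y} xy x∉ with y ∈? R i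
        ... | yes y∈ = y∈
        ... | no  y∉ = contradiction (Adj-sym G xy) (proj₂ (proj₁ (f-inS i)) y x
          ([ id , (λ y∈ → contradiction y∈ y∉) ]′ (proj₁ (proj₁ (f-inS i)) y)) y∉ (∉L⇒∈R i x∉) x∉)
        both : u ∈ R i × v ∈ R i
        both with u ∈? L i | v ∈? L i
        ... | yes u∈L | yes v∈L = contradiction (u∈L , v∈L) ¬uv∈
        ... | no  u∉  | _       = ∉L⇒∈R i u∉ , other uv u∉
        ... | yes _   | no  v∉  = other (Adj-sym G uv) v∉ , ∉L⇒∈R i v∉

    ¬pathWidth : 0 < n → ¬ PathWidthAtLeast G (k ∸ 1)
    ¬pathWidth 0<n wide = <⇒≱ width<k-1 (wide D)
      where
      D : PathDecomposition G
      D = bags-decomposition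
      open PathDecomposition D using (bag; covers-vertices)
      sizes : ℕ
      sizes = foldr _⊔_ 0 (map (λ i → ∣ bag i ∣) (allFin r))
      sizes≤ : sizes ≤ k ∸ 1
      sizes≤ = max≤ (λ i → ∣ bag i ∣) (allFin r) λ i → ∸-monoˡ-≤ 1 (Step.gap<k (f-step (toℕ i)))
      -- A non-empty bag is needed because `∸` truncates: only then is the width strictly below
      -- `sizes`.
      0<sizes : 0 < sizes
      0<sizes with covers-vertices (fromℕ< 0<n)
      ... | i , v∈ = ≤-trans (∈⇒0<∣∣ v∈) (f≤max (λ i → ∣ bag i ∣) (∈-allFin i))
      width<k-1 : width G D < k ∸ 1
      width<k-1 = <-≤-trans (∸-monoʳ-< z<s 0<sizes) sizes≤

-- Trees

module _ {A : Set} (f : A → A) where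

  iter : A → ℕ → A
  iter x zero    = x
  iter x (suc i) = f (iter x i)

  iter-+ : ∀ x i j → iter x (i + j) ≡ iter (iter x j) i
  iter-+ x zero    j = refl
  iter-+ x (suc i) j = cong f (iter-+ x i j)

module _ (T : Graph m) (next : Fin m → Fin m) (adj-next : ∀ x → Adj T x (next x))
         (¬backtrack : ∀ x → next (next x) ≢ x) where

  private
    walk : Fin m → ℕ → Fin m
    walk = iter next

    Period : Fin m → ℕ → Set
    Period x p = 0 < p × walk x p ≡ x

    -- Among m + 1 positions of the walk two coincide. The walk is restarted at the repeated vertex,
    -- because `v` itself need not recur.
    period : Fin m → ∃₂ Period
    period v with pigeonhole ≤-refl (walk v ∘ toℕ {suc m})
    ... | i , j , i<j , eq = walk v (toℕ i) , toℕ j ∸ toℕ i , m<n⇒0<n∸m i<j ,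
      trans (sym (iter-+ next v (toℕ j ∸ toℕ i) (toℕ i)))
            (trans (cong (walk v) (m∸n+n≡m (<⇒≤ i<j))) (sym eq))

    least-period : ∀ x p → Acc _<_ p → Period x p → ∃ λ p → Period x p × (∀ q → q < p → ¬ Period x q)
    least-period x p (acc rs) per with anyUpTo? (λ q → (0 <? q) ×-dec (walk x q Fin.≟ x)) p
    ... | yes (q , q<p , per′) = least-period x q (rs q<p) per′
    ... | no  none             = p , per , λ q q<p per′ → none (q , q<p , per′)

    -- Period 1 would be a loop and period 2 a turning back; a least period of at least 3 runs
    -- around a cycle.
    cycle : ∀ x p → Period x p → (∀ q → q < p → ¬ Period x q) → HasCycle T
    cycle x 1 (_ , eq) _ = contradiction
      (trans (sym (Graph.adj-irrefl T x)) (subst (Adj T x) eq (adj-next x))) λ ()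
    cycle x 2 (_ , eq) _ = contradiction eq (¬backtrack x)
    cycle x p@(suc (suc (suc q))) (_ , eq) least =
      x , applyUpTo (walk x ∘ suc) (suc q) , walk x (suc (suc q)) ,
      subst Unique shape (Unique.applyUpTo⁺₁ (walk x) p distinct) ,
      subst (1 ≤_) (sym (length-applyUpTo (walk x ∘ suc) (suc q))) (s≤s z≤n) ,
      subst (Linked (Adj T)) shape (Linked.applyUpTo⁺₂ (walk x) p λ i → adj-next (walk x i)) ,
      subst (Adj T (walk x (suc (suc q)))) eq (adj-next (walk x (suc (suc q))))
      where
      shape : applyUpTo (walk x) p ≡ x ∷ (applyUpTo (walk x ∘ suc) (suc q) ∷ʳ walk x (suc (suc q)))
      shape = cong (x ∷_) (sym (applyUpTo-∷ʳ (walk x ∘ suc) (suc q)))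
      distinct : ∀ {i j} → i < j → j < p → walk x i ≢ walk x j
      -- If positions `i` and `j` agree, leaving out the part between them gives a shorter period.
      distinct {i} {j} i<j j<p same = least (p ∸ j + i) shorter
        (m≤n⇒m≤n+o i (m<n⇒0<n∸m j<p) , returns)
        where
        shorter : p ∸ j + i < p
        shorter = <-≤-trans (+-monoʳ-< (p ∸ j) i<j) (≤-reflexive (m∸n+n≡m (<⇒≤ j<p)))
        returns : walk x (p ∸ j + i) ≡ x
        returns = begin
          walk x (p ∸ j + i)      ≡⟨ iter-+ next x (p ∸ j) i ⟩
          walk (walk x i) (p ∸ j) ≡⟨ cong (λ y → walk y (p ∸ j)) same ⟩
          walk (walk x j) (p ∸ j) ≡⟨ iter-+ next x (p ∸ j) j ⟨
          walk x (p ∸ j + j)      ≡⟨ cong (walk x) (m∸n+n≡m (<⇒≤ j<p)) ⟩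
          walk x p                ≡⟨ eq ⟩
          x                       ∎
          where open ≡-Reasoning

  nonBacktracking⇒cycle : Fin m → HasCycle T
  nonBacktracking⇒cycle v with period v
  ... | x , p , per with least-period x p (<-wellFounded p) per
  ...   | q , per′ , least = cycle x q per′ least

-- The star at a node is not contained in the tangle, so the tangle orients some edge away from the
-- node. Turning back along it would put a label and its inverse into the tangle.
tangle⇒¬STree : (G : Graph n) (k : ℕ) → Σ (Subset n → Subset n → Bool) (F2Tangle G k) → ¬ F2STree G k
tangle⇒¬STree G k (O , 𝒯) tree =
  proj₂ isTree (nonBacktracking⇒cycle T (proj₁ ∘ next) (proj₁ ∘ proj₂ ∘ next) ¬back (proj₁ hasEdge))
  where
  open F2Tangle 𝒯
  open Tangle G k 𝒯
  open F2STree tree renaming (m to nodes)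
  outward : ∀ {x t s} → Adj T x t → α x t ≡ s → ¬ In s → Adj T t x × In (α t x)
  outward {x} {t} xt refl ¬in = Adj-sym T xt , subst In (sym (α-inv x t xt))
    ([ (λ p → contradiction p ¬in) , id ]′ (proj₁ (orients (α x t) (α-S x t xt))))
  next : ∀ t → ∃ λ x → Adj T t x × In (α t x)
  next t with α-node t
  ... | s₁ , s₂ , star , _ , (x₁ , x₁t , eq₁) , (x₂ , x₂t , eq₂) with in? s₁ | in? s₂
  ...   | no  ¬1 | _      = x₁ , outward x₁t eq₁ ¬1
  ...   | yes _  | no ¬2  = x₂ , outward x₂t eq₂ ¬2
  ...   | yes s₁∈ | yes s₂∈ = ⊥-elim (F-free s₁ s₂ s₁∈ s₂∈ star)
  ¬back : ∀ t → proj₁ (next (proj₁ (next t))) ≢ t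
  ¬back t eq with next t
  ... | x , tx , t→x = ¬both (α t x) t→x (subst In (α-inv t x tx)
    (subst (λ y → In (α x y)) eq (proj₂ (proj₂ (next x)))))

-- Path graphs

Reachable-trans : {T : Graph m} {x y z : Fin m} → Reachable T x y → Reachable T y z → Reachable T x z
Reachable-trans here       q = q
Reachable-trans (step e p) q = step e (Reachable-trans p q)

Reachable-sym : {T : Graph m} {x y : Fin m} → Reachable T x y → Reachable T y x
Reachable-sym         here       = here
Reachable-sym {T = T} (step e p) = Reachable-trans (Reachable-sym p) (step (Adj-sym T e) here)

Linked-first-last : {A : Set} {_↝_ _◁_ : A → A → Set} →
                    (∀ {x y z} → x ◁ y → y ◁ z → x ◁ z) → (∀ {x y} → x ↝ y → x ◁ y) →
                    ∀ {x y} zs → Linked _↝_ (x ∷ (zs ∷ʳ y)) → x ◁ y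
Linked-first-last ◁-trans ↝⇒◁ []       (x↝y ∷ _)  = ↝⇒◁ x↝y
Linked-first-last ◁-trans ↝⇒◁ (z ∷ zs) (x↝z ∷ lk) =
  ◁-trans (↝⇒◁ x↝z) (Linked-first-last ◁-trans ↝⇒◁ zs lk)

module _ (m : ℕ) where

  Succ : Fin m → Fin m → Set
  Succ x y = toℕ y ≡ suc (toℕ x)

  succ? : ∀ x y → Dec (Succ x y)
  succ? x y = toℕ y ≟ suc (toℕ x)

  pathGraph : Graph m
  pathGraph = record
    { adj        = λ x y → does (succ? x y ⊎-dec succ? y x)
    ; adj-sym    = λ x y → Bool.∨-comm (does (succ? x y)) (does (succ? y x))
    ; adj-irrefl = λ x → dec-false (succ? x x ⊎-dec succ? x x) [ 1+n≢n ∘ sym , 1+n≢n ∘ sym ]′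
    }

  adj⁺ : ∀ {x y} → Succ x y ⊎ Succ y x → Adj pathGraph x y
  adj⁺ {x} {y} = dec-true (succ? x y ⊎-dec succ? y x)

  adj⁻ : ∀ {x y} → Adj pathGraph x y → Succ x y ⊎ Succ y x
  adj⁻ {x} {y} = does⇒ (succ? x y ⊎-dec succ? y x)

  module _ {_↝_ : Fin m → Fin m → Set} (split : ∀ {x y} → Adj pathGraph x y → x ↝ y ⊎ y ↝ x)
           (unique : ∀ {x y z} → x ↝ y → z ↝ y → x ≡ z) where

    -- A walk without repetitions cannot turn round: an edge taken against `↝` would lead back to
    -- `x`, the only vertex before `y`. The relation is a parameter so as to cover both directions.
    straight : ∀ {x y zs} → x ↝ y → Unique (x ∷ y ∷ zs) → Linked (Adj pathGraph) (x ∷ y ∷ zs) →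
               Linked _↝_ (x ∷ y ∷ zs)
    straight {zs = []}     x↝y _                        _             = x↝y ∷ [-]
    straight {zs = z ∷ zs} x↝y ((_ ∷ x≢z ∷ _) ∷ y-uniq) (_ ∷ yz ∷ lk) with split yz
    ... | inj₁ y↝z = x↝y ∷ straight y↝z y-uniq (yz ∷ lk)
    ... | inj₂ z↝y = contradiction (unique x↝y z↝y) x≢z

  -- A cycle would keep the direction of its first edge from `x` to `v`, so its last vertex `y`
  -- would lie beyond `v` and not be adjacent to `x`.
  pathGraph-acyclic : ¬ HasCycle pathGraph
  pathGraph-acyclic (x , []     , y , _    , ()  , _)
  pathGraph-acyclic (x , v ∷ vs , y , uniq , _ , lk@(xv ∷ _) , yx) = [ ascending , descending ]′ (adj⁻ xv)
    where
    Succ-injective : ∀ {x y z} → Succ x y → Succ z y → x ≡ z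
    Succ-injective e e′ = toℕ-injective (suc-injective (trans (sym e) e′))
    Succ-functional : ∀ {x y z} → Succ y x → Succ y z → x ≡ z
    Succ-functional e e′ = toℕ-injective (trans e (sym e′))
    two-above : ∀ {a b c} → Succ a b → Succ b c → toℕ a < toℕ c
    two-above e e′ = <-trans (≤-reflexive (sym e)) (≤-reflexive (sym e′))
    ascending : ¬ Succ x v
    ascending x↝v with straight adj⁻ Succ-injective x↝v uniq lk
    ... | _ ∷ lk′ = [ (λ y↝x → <-asym v<y (two-above y↝x x↝v))
                    , (λ x↝y → <-irrefl (trans x↝v (sym x↝y)) v<y) ]′ (adj⁻ yx)
      where
      v<y : toℕ v < toℕ y
      v<y = Linked-first-last {_◁_ = λ a b → toℕ a < toℕ b} <-trans (≤-reflexive ∘ sym) vs lk′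
    descending : ¬ Succ v x
    descending v↝x with straight (Sum.swap ∘ adj⁻) Succ-functional v↝x uniq lk
    ... | _ ∷ lk′ = [ (λ y↝x → <-irrefl (suc-injective (trans (sym y↝x) v↝x)) y<v)
                    , (λ x↝y → <-asym y<v (two-above v↝x x↝y)) ]′ (adj⁻ yx)
      where
      y<v : toℕ y < toℕ v
      y<v = Linked-first-last {_◁_ = λ a b → toℕ b < toℕ a} (flip <-trans) (≤-reflexive ∘ sym) vs lk′

pathGraph-isTree : ∀ m → IsTree (pathGraph (suc m))
pathGraph-isTree m = (λ x y → Reachable-trans (Reachable-sym (from-zero x)) (from-zero y)) , pathGraph-acyclic (suc m)
  where
  from-zero : ∀ x → Reachable (pathGraph (suc m)) zero x
  from-zero = <-weakInduction (Reachable (pathGraph (suc m)) zero) here λ i p →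
    Reachable-trans p (step (adj⁺ (suc m) (inj₁ (cong suc (sym (toℕ-inject₁ i))))) here)

module _ (G : Graph n) (k : ℕ) (0<k : 0 < k) (σ : Sequence G k ⊥S (inv ⊥S)) where
  open Sequence σ

  private
    -- There are r + 2 nodes, so that the r + 1 edges carry `f 0` to `f r`, directed upwards. Both
    -- leaves then receive `inv ⊥S`, and every inner node the star of one step.
    α : Fin (suc (suc r)) → Fin (suc (suc r)) → Sep n
    α x y with toℕ x <? toℕ y
    ... | yes _ = f (toℕ x)
    ... | no  _ = inv (f (toℕ y))

    α-succ : ∀ x y → Succ _ x y → α x y ≡ f (toℕ x)
    α-succ x y xy with toℕ x <? toℕ y
    ... | yes _  = refl
    ... | no x≮y = contradiction (≤-reflexive (sym xy)) x≮y

    α-pred : ∀ x y → Succ _ y x → α x y ≡ inv (f (toℕ y))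
    α-pred x y yx with toℕ x <? toℕ y
    ... | yes x<y = contradiction (≤-reflexive (sym yx)) (<-asym x<y)
    ... | no  _   = refl

    f∈S : ∀ i → InS G k (f i)
    f∈S i = Step.source (f-step i)

    α∈S : ∀ x y → InS G k (α x y)
    α∈S x y with toℕ x <? toℕ y
    ... | yes _ = f∈S (toℕ x)
    ... | no  _ = InS-inv G (f (toℕ y)) (f∈S (toℕ y))

    α-inv : ∀ x y → Adj (pathGraph _) x y → α y x ≡ inv (α x y)
    α-inv x y xy with adj⁻ _ xy
    ... | inj₁ x↝y = trans (α-pred y x x↝y) (cong inv (sym (α-succ x y x↝y)))
    ... | inj₂ y↝x = trans (α-succ y x y↝x) (cong inv (sym (α-pred x y y↝x)))

    inv⊥S-star : InF2 G k (inv ⊥S) (inv ⊥S)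
    inv⊥S-star = ∈S , ∈S , (λ s≢s → contradiction refl s≢s) ,
      ≤-<-trans (≤-trans (∣p∩q∣≤∣p∣ (⊥ {n = n}) ⊥) (≤-reflexive (∣⊥∣≡0 n))) 0<k
      where
      ∈S : InS G k (inv ⊥S)
      ∈S = InS-inv G ⊥S (InS-⊥S G 0<k)

    step-star : ∀ {s t} → Step G k s t → InF2 G k s (inv t)
    step-star {s} {t} (mkStep a b c d) = a , InS-inv G t b , (λ _ → c , ≤S-inv c) , d

    Node : Fin (suc (suc r)) → Set
    Node t = Σ (Sep n) λ s₁ → Σ (Sep n) λ s₂ →
      InF2 G k s₁ s₂ ×
      (∀ x → Adj (pathGraph _) x t → (α x t ≡ s₁) ⊎ (α x t ≡ s₂)) ×
      (∃ λ x → Adj (pathGraph _) x t × α x t ≡ s₁) ×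
      (∃ λ x → Adj (pathGraph _) x t × α x t ≡ s₂)

    leaf : ∀ t x → Adj (pathGraph _) x t → (∀ y → Adj (pathGraph _) y t → α y t ≡ inv ⊥S) → Node t
    leaf t x xt all≡ = inv ⊥S , inv ⊥S , inv⊥S-star , (λ y yt → inj₁ (all≡ y yt)) ,
      (x , xt , all≡ x xt) , (x , xt , all≡ x xt)

    node : ∀ t → Node t
    node zero = leaf zero (suc zero) (adj⁺ (suc (suc r)) {suc zero} {zero} (inj₂ refl)) to-zero
      where
      to-zero : ∀ y → Adj (pathGraph _) y zero → α y zero ≡ inv ⊥S
      to-zero y e with adj⁻ _ e
      ... | inj₁ ()
      ... | inj₂ 0↝y = trans (α-pred y zero 0↝y) (cong inv f-0)
    node t@(suc i) with toℕ i <? r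
    ... | yes i<r = f (toℕ i) , inv (f (suc (toℕ i))) , step-star (f-step (toℕ i)) , nbrs ,
      (inject₁ i , adj⁺ _ (inj₁ pred↝t) , trans (α-succ (inject₁ i) t pred↝t) (cong f (toℕ-inject₁ i))) ,
      (next , adj⁺ _ (inj₂ t↝next) , α-pred next t t↝next)
      where
      pred↝t : Succ _ (inject₁ i) t
      pred↝t = cong suc (sym (toℕ-inject₁ i))
      next : Fin (suc (suc r))
      next = fromℕ< (s≤s (s≤s i<r))
      t↝next : Succ _ t next
      t↝next = toℕ-fromℕ< (s≤s (s≤s i<r))
      nbrs : ∀ x → Adj (pathGraph _) x t → α x t ≡ f (toℕ i) ⊎ α x t ≡ inv (f (suc (toℕ i)))
      nbrs x e with adj⁻ _ e
      ... | inj₁ x↝t = inj₁ (trans (α-succ x t x↝t) (cong f (sym (suc-injective x↝t))))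
      ... | inj₂ t↝x = inj₂ (α-pred x t t↝x)
    ... | no i≮r = leaf t (inject₁ i) (adj⁺ _ (inj₁ (cong suc (sym (toℕ-inject₁ i))))) to-last
      where
      i≡r : toℕ i ≡ r
      i≡r = ≤-antisym (s≤s⁻¹ (toℕ<n i)) (≮⇒≥ i≮r)
      to-last : ∀ y → Adj (pathGraph _) y t → α y t ≡ inv ⊥S
      to-last y e with adj⁻ _ e
      ... | inj₁ y↝t = trans (α-succ y t y↝t) (trans (cong f (trans (sym (suc-injective y↝t)) i≡r)) f-r)
      ... | inj₂ t↝y = contradiction (toℕ<n y) (≤⇒≯ (≤-reflexive (sym
        (trans t↝y (cong (λ j → suc (suc j)) i≡r)))))

  sequence⇒STree : F2STree G k
  sequence⇒STree = record
    { T       = pathGraph (suc (suc r))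
    ; isTree  = pathGraph-isTree (suc r)
    ; hasEdge = zero , suc zero , adj⁺ (suc (suc r)) {zero} {suc zero} (inj₁ refl)
    ; α       = α
    ; α-S     = λ x y _ → α∈S x y
    ; α-inv   = α-inv
    ; α-node  = node
    }

theorem5p10 : ∀ (n : ℕ) → 0 < n → (G : Graph n) → (k : ℕ) → 0 < k →
    let i   = Σ (Subset n → Bool) (Blockage G k)
        ii  = Σ (Subset n → Subset n → Bool) (F2Tangle G k)
        iii = ¬ F2STree G k
        iv  = PathWidthAtLeast G (k ∸ 1)
    in (i ⇔ ii) × (i ⇔ iii) × (i ⇔ iv)
theorem5p10 n 0<n G k 0<k =
  mk⇔ i⇒ii ii⇒i ,
  mk⇔ (tangle⇒¬STree G k ∘ i⇒ii) (λ ¬tree → ii⇒i (¬sequence⇒tangle (¬tree ∘ sequence⇒STree G k 0<k))) ,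
  mk⇔ (tangle⇒pathWidth G k 0<k ∘ i⇒ii) (λ wide → ii⇒i (¬sequence⇒tangle λ σ → ¬pathWidth G k σ 0<n wide))
  where
  i⇒ii : Σ (Subset n → Bool) (Blockage G k) → Σ (Subset n → Subset n → Bool) (F2Tangle G k)
  i⇒ii = blockage⇒tangle G k 0<n 0<k
  ii⇒i : Σ (Subset n → Subset n → Bool) (F2Tangle G k) → Σ (Subset n → Bool) (Blockage G k)
  ii⇒i = tangle⇒blockage G k
  -- The mere absence of a sequence suffices for a tangle, so (iii) and (iv) both lead here.
  ¬sequence⇒tangle : ¬ Sequence G k ⊥S (inv ⊥S) → Σ (Subset n → Subset n → Bool) (F2Tangle G k)
  ¬sequence⇒tangle none = orientation⇒tangle G k 0<k (fullOrientation G k 0<k (none ∘ ⇝⇒sequence G k))
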